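{- Let $b \geq 2$ be an integer and let $a_1a_2a_3\ldots$ be an infinite de Bruijn word over the alphabet $\{0,1,\ldots,b-1\}$. Let $\alpha = 0.a_1a_2a_3\ldots$ be the real number with base-$b$ digits $a_1,a_2,\ldots$, i.e. $\alpha=\sum_{k\ge1}a_k b^{ -k}$. Then the sequence $(\{b^n \alpha\})_{n \in \mathbb{N}}$ does not have Poissonian pair correlations.
   Context: $\{x\}$ denotes the fractional part of $x$ and $\|x\|$ the distance from $x$ to the nearest integer. A sequence $(x_n)_{n\in\mathbb{N}}$ in $[0,1)$ has Poissonian pair correlations if for every $s \geq 0$, $F_N(s) := \frac{1}{N}\#\{1 \leq l \neq m \leq N : \|x_l - x_m\| \leq s/N\} \to 2s$ as $N\to\infty$. A (non-cyclic) de Bruijn word of order $m$ over an alphabet $A$ is a word of length $|A|^m+m-1$ in which every word of length $m$ over $A$ occurs (as a factor of consecutive letters) exactly once. An infinite de Bruijn word $w=a_1a_2\ldots$ over an alphabet $A$ with at least three symbols is an infinite word such that for every $m$, $a_1\ldots a_{|A|^m+m-1}$ is a de Bruijn word of order $m$; if the alphabet has two symbols, it is an infinite word such that for every odd $m$, $a_1\ldots a_{|A|^m+m-1}$ is a de Bruijn word of order $m$. -}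

module Defs where

open import Data.Fin.Base using (Fin; toℕ)
import Data.Fin.Properties as Fin
open import Data.Integer.Base as ℤ using (ℤ; +_)
import Data.Integer.DivMod as ℤ
import Data.Integer.Properties as ℤ
import Data.Integer.Solver as ℤS
open import Data.List.Base using (List; length; _++_; applyUpTo)
open import Data.List.Membership.Propositional using (_∈_)
open import Data.List.Relation.Unary.Unique.Propositional using (Unique)
open import Data.Nat.Base as ℕ using (ℕ; zero; suc; NonTrivial)
open import Data.Nat.Divisibility using (_∣_)
import Data.Nat.Properties as ℕ
open import Data.Product.Base using (∃; ∃₂; _×_; _,_)
open import Data.Product using (∃!)
open import Data.Rational.Base as ℚ using (ℚ; 0ℚ; 1ℚ; ½; ∣_∣; floor; ceiling; round)
import Data.Rational.Properties as ℚ
open import Data.Rational.Solver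
import Data.Rational.Unnormalised.Base as ℚᵘ
import Data.Rational.Unnormalised.Properties as ℚᵘ
open import Data.Bool.Base using (true; false)
open import Data.Sum.Base using (inj₁; inj₂)
open import Function.Base using (_$_; _∘_)
open import Function.Bundles using (_⇔_)
open import Relation.Binary.Definitions using (tri<; tri≈; tri>)
open import Relation.Binary.PropositionalEquality
  using (_≡_; _≢_; refl; sym; trans; cong; subst; subst₂)
open import Relation.Nullary using (¬_)
open import Relation.Unary using (Pred)
open import Level using (0ℓ)

open +-*-Solver

fromℤ : ℤ → ℚ
fromℤ k = k ℚ./ 1

∣p-q∣≡∣q-p∣ : ∀ p q → ∣ p ℚ.- q ∣ ≡ ∣ q ℚ.- p ∣
∣p-q∣≡∣q-p∣ p q = trans (sym (ℚ.∣-p∣≡∣p∣ (p ℚ.- q)))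
  (cong ∣_∣ (solve 2 (λ x y → :- (x :- y) := y :- x) refl p q))

p≤∣p∣ : ∀ p → p ℚ.≤ ∣ p ∣
p≤∣p∣ p with ℚ.≤-total 0ℚ p
... | inj₁ 0≤p = ℚ.≤-reflexive (sym (ℚ.0≤p⇒∣p∣≡p 0≤p))
... | inj₂ p≤0 = ℚ.≤-trans p≤0 (ℚ.0≤∣p∣ p)

-p≤∣p∣ : ∀ p → ℚ.- p ℚ.≤ ∣ p ∣
-p≤∣p∣ p = subst (ℚ.- p ℚ.≤_) (ℚ.∣-p∣≡∣p∣ p) (p≤∣p∣ (ℚ.- p))

∣p∣≤ : ∀ {p e} → p ℚ.≤ e → ℚ.- p ℚ.≤ e → ∣ p ∣ ℚ.≤ e
∣p∣≤ {p} {e} p≤e -p≤e with ℚ.∣p∣≡p∨∣p∣≡-p p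
... | inj₁ eq = subst (ℚ._≤ e) (sym eq) p≤e
... | inj₂ eq = subst (ℚ._≤ e) (sym eq) -p≤e

∣-∣-triangle : ∀ p q r → ∣ p ℚ.- r ∣ ℚ.≤ ∣ p ℚ.- q ∣ ℚ.+ ∣ q ℚ.- r ∣
∣-∣-triangle p q r = subst (ℚ._≤ ∣ p ℚ.- q ∣ ℚ.+ ∣ q ℚ.- r ∣)
  (cong ∣_∣ (solve 3 (λ x y z → (x :- y) :+ (y :- z) := x :- z) refl p q r))
  (ℚ.∣p+q∣≤∣p∣+∣q∣ (p ℚ.- q) (q ℚ.- r))

p≤q+r⇒p-q≤r : ∀ {p q r} → p ℚ.≤ q ℚ.+ r → p ℚ.- q ℚ.≤ r
p≤q+r⇒p-q≤r {p} {q} {r} h = subst (p ℚ.- q ℚ.≤_)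
  (solve 2 (λ x y → (x :+ y) :- x := y) refl q r) (ℚ.+-monoˡ-≤ (ℚ.- q) h)

lipschitz : (f : ℚ → ℚ) → (∀ p q → f p ℚ.≤ f q ℚ.+ ∣ p ℚ.- q ∣) →
            ∀ p q → ∣ f p ℚ.- f q ∣ ℚ.≤ ∣ p ℚ.- q ∣
lipschitz f h p q = ∣p∣≤ (p≤q+r⇒p-q≤r (h p q))
  (subst (ℚ._≤ ∣ p ℚ.- q ∣) (solve 2 (λ x y → y :- x := :- (x :- y)) refl (f p) (f q))
    (p≤q+r⇒p-q≤r (subst (λ z → f q ℚ.≤ f p ℚ.+ z) (∣p-q∣≡∣q-p∣ q p) (h q p))))

half-pos : ∀ {ε} → 0ℚ ℚ.< ε → 0ℚ ℚ.< ½ ℚ.* ε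
half-pos {ε} 0<ε = subst (ℚ._< ½ ℚ.* ε) (ℚ.*-zeroʳ ½) (ℚ.*-monoʳ-<-pos ½ 0<ε)

half+half : ∀ ε → ½ ℚ.* ε ℚ.+ ½ ℚ.* ε ≡ ε
half+half ε = trans (sym (ℚ.*-distribʳ-+ ε ½ ½)) (ℚ.*-identityˡ ε)

/-mono-≤ : ∀ i m j n .{{_ : ℕ.NonZero m}} .{{_ : ℕ.NonZero n}} →
           i ℤ.* + n ℤ.≤ j ℤ.* + m → i ℚ./ m ℚ.≤ j ℚ./ n
/-mono-≤ i (suc m) j (suc n) h = ℚ.toℚᵘ-cancel-≤
  (ℚᵘ.≤-respˡ-≃ (ℚᵘ.≃-sym (ℚ.toℚᵘ-fromℚᵘ (ℚᵘ.mkℚᵘ i m)))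
    (ℚᵘ.≤-respʳ-≃ (ℚᵘ.≃-sym (ℚ.toℚᵘ-fromℚᵘ (ℚᵘ.mkℚᵘ j n))) (ℚᵘ.*≤* h)))

/-+ : ∀ i j n .{{_ : ℕ.NonZero n}} → i ℚ./ n ℚ.+ j ℚ./ n ≡ (i ℤ.+ j) ℚ./ n
/-+ i j n@(suc n-1) = ℚ.toℚᵘ-injective
  (ℚᵘ.≃-trans (ℚ.toℚᵘ-homo-+ (i ℚ./ n) (j ℚ./ n))
  (ℚᵘ.≃-trans (ℚᵘ.+-cong (ℚ.toℚᵘ-fromℚᵘ (ℚᵘ.mkℚᵘ i n-1)) (ℚ.toℚᵘ-fromℚᵘ (ℚᵘ.mkℚᵘ j n-1)))
  (ℚᵘ.≃-trans (ℚᵘ.*≡* (eq i j (+ n)))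
  (ℚᵘ.≃-sym (ℚ.toℚᵘ-fromℚᵘ (ℚᵘ.mkℚᵘ (i ℤ.+ j) n-1))))))
  where
  module S = ℤS.+-*-Solver
  eq : ∀ i j n → (i ℤ.* n ℤ.+ j ℤ.* n) ℤ.* n ≡ (i ℤ.+ j) ℤ.* (n ℤ.* n)
  eq = S.solve 3 (λ i j n → (i S.:* n S.:+ j S.:* n) S.:* n S.:= (i S.:+ j) S.:* (n S.:* n)) refl

fromℤ-mono-≤ : ∀ {j k} → j ℤ.≤ k → fromℤ j ℚ.≤ fromℤ k
fromℤ-mono-≤ {j} {k} j≤k = /-mono-≤ j 1 k 1 (ℤ.*-monoʳ-≤-nonNeg (+ 1) j≤k)

fromℤ-suc-≤ : ∀ {j k} → j ℤ.< k → 1ℚ ℚ.+ fromℤ j ℚ.≤ fromℤ k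
fromℤ-suc-≤ {j} j<k = subst (ℚ._≤ _) (sym (/-+ (+ 1) j 1)) (fromℤ-mono-≤ (ℤ.i<j⇒suc[i]≤j j<k))

fromℤ-neg : ∀ k → fromℤ (ℤ.- k) ≡ ℚ.- fromℤ k
fromℤ-neg (+ zero)   = refl
fromℤ-neg ℤ.+[1+ n ] = refl
fromℤ-neg ℤ.-[1+ n ] = solve 1 (λ x → x := :- (:- x)) refl (fromℤ (+ suc n))

ceiling≡ : ∀ p → ceiling p ≡ ℤ.- floor (ℚ.- p)
ceiling≡ (ℚ.mkℚ _ _ _) = refl

fromℤ[floor]≤ : ∀ q → fromℤ (floor q) ℚ.≤ q
fromℤ[floor]≤ q@(ℚ.mkℚ n d-1 _) = ℚ.toℚᵘ-cancel-≤
  (ℚᵘ.≤-respˡ-≃ (ℚᵘ.≃-sym (ℚ.toℚᵘ-fromℚᵘ (ℚᵘ.mkℚᵘ (floor q) 0)))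
    (ℚᵘ.*≤* (subst (floor q ℤ.* + suc d-1 ℤ.≤_) (sym (ℤ.*-identityʳ n))
      (ℤ.[n/d]*d≤n n (+ suc d-1)))))

≤1+fromℤ[floor] : ∀ q → q ℚ.≤ 1ℚ ℚ.+ fromℤ (floor q)
≤1+fromℤ[floor] q@(ℚ.mkℚ n d-1 _) = subst (q ℚ.≤_) (sym (/-+ (+ 1) (floor q) 1)) $
  ℚ.toℚᵘ-cancel-≤
  (ℚᵘ.≤-respʳ-≃ (ℚᵘ.≃-sym (ℚ.toℚᵘ-fromℚᵘ (ℚᵘ.mkℚᵘ (ℤ.suc (floor q)) 0)))
    (ℚᵘ.*≤* (subst (ℤ._≤ ℤ.suc (floor q) ℤ.* + suc d-1) (sym (ℤ.*-identityʳ n))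
      (ℤ.<⇒≤ (subst (λ z → n ℤ.< ℤ.suc z ℤ.* + suc d-1)
        (sym (ℤ.div-pos-is-/ℕ n (suc d-1))) (ℤ.n<s[n/ℕd]*d n (suc d-1)))))))

‖_‖ℚ : ℚ → ℚ
‖ q ‖ℚ = ∣ q ℚ.- fromℤ (round q) ∣

‖q‖ℚ≤½ : ∀ q → ‖ q ‖ℚ ℚ.≤ ½
‖q‖ℚ≤½ q with q ℚ.≤ᵇ 0ℚ
... | true  = ∣p∣≤
  (subst₂ ℚ._≤_
    (trans (solve 2 (λ x f → f :+ (x :- con ½) :+ con ½ := x :- (:- f)) refl q f)
      (cong (λ z → q ℚ.- z) (sym f⁻)))
    (solve 1 (λ x → (:- (x :- con ½)) :+ (x :- con ½) :+ con ½ := con ½) refl q)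
    (ℚ.+-monoˡ-≤ ½ (ℚ.+-monoˡ-≤ (q ℚ.- ½) (fromℤ[floor]≤ p))))
  (subst₂ ℚ._≤_
    (trans (solve 2 (λ x f → (:- (x :- con ½)) :+ (:- f :- con ½) := :- (x :- (:- f))) refl q f)
      (cong (λ z → ℚ.- (q ℚ.- z)) (sym f⁻)))
    (solve 1 (λ f → (con 1ℚ :+ f) :+ (:- f :- con ½) := con ½) refl f)
    (ℚ.+-monoˡ-≤ (ℚ.- f ℚ.- ½) (≤1+fromℤ[floor] p)))
  where
  p = ℚ.- (q ℚ.- ½)
  f = fromℤ (floor p)
  f⁻ = trans (cong fromℤ (ceiling≡ (q ℚ.- ½))) (fromℤ-neg (floor p))
... | false = ∣p∣≤
  (subst₂ ℚ._≤_
    (solve 2 (λ x f → (x :+ con ½) :+ (:- f :- con ½) := x :- f) refl q f)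
    (solve 1 (λ f → (con 1ℚ :+ f) :+ (:- f :- con ½) := con ½) refl f)
    (ℚ.+-monoˡ-≤ (ℚ.- f ℚ.- ½) (≤1+fromℤ[floor] p)))
  (subst₂ ℚ._≤_
    (solve 2 (λ x f → f :- x := :- (x :- f)) refl q f)
    (solve 1 (λ x → (x :+ con ½) :- x := con ½) refl q)
    (ℚ.+-monoˡ-≤ (ℚ.- q) (fromℤ[floor]≤ p)))
  where
  p = q ℚ.+ ½
  f = fromℤ (floor p)

‖q‖ℚ≤∣q-k∣ : ∀ q k → ‖ q ‖ℚ ℚ.≤ ∣ q ℚ.- fromℤ k ∣
‖q‖ℚ≤∣q-k∣ q k with ℤ.<-cmp k (round q)
... | tri≈ _ refl _ = ℚ.≤-refl
... | tri< k<r _ _ = ℚ.≤-trans (‖q‖ℚ≤½ q) (ℚ.≤-trans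
  (subst₂ ℚ._≤_
    (solve 3 (λ x k r → (:- (x :- r) :+ (con 1ℚ :+ k)) :+ (x :- r :- k :- con ½) := con ½)
      refl q K R)
    (solve 3 (λ x k r → (con ½ :+ r) :+ (x :- r :- k :- con ½) := x :- k) refl q K R)
    (ℚ.+-monoˡ-≤ (q ℚ.- R ℚ.- K ℚ.- ½)
      (ℚ.+-mono-≤ (ℚ.≤-trans (-p≤∣p∣ (q ℚ.- R)) (‖q‖ℚ≤½ q)) (fromℤ-suc-≤ k<r))))
  (p≤∣p∣ (q ℚ.- K)))
  where K = fromℤ k; R = fromℤ (round q)
... | tri> _ _ r<k = ℚ.≤-trans (‖q‖ℚ≤½ q) (ℚ.≤-trans
  (subst₂ ℚ._≤_
    (solve 2 (λ x r → ((x :- r) :+ (con 1ℚ :+ r)) :+ (:- x :- con ½) := con ½)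
      refl q R)
    (solve 2 (λ x k → (con ½ :+ k) :+ (:- x :- con ½) := :- (x :- k)) refl q K)
    (ℚ.+-monoˡ-≤ (ℚ.- q ℚ.- ½)
      (ℚ.+-mono-≤ (ℚ.≤-trans (p≤∣p∣ (q ℚ.- R)) (‖q‖ℚ≤½ q)) (fromℤ-suc-≤ r<k))))
  (-p≤∣p∣ (q ℚ.- K)))
  where K = fromℤ k; R = fromℤ (round q)

‖-‖ℚ-lipschitz : ∀ p q → ∣ ‖ p ‖ℚ ℚ.- ‖ q ‖ℚ ∣ ℚ.≤ ∣ p ℚ.- q ∣
‖-‖ℚ-lipschitz = lipschitz ‖_‖ℚ λ p q → ℚ.≤-trans (‖q‖ℚ≤∣q-k∣ p (round q))
  (subst (∣ p ℚ.- fromℤ (round q) ∣ ℚ.≤_) (ℚ.+-comm ∣ p ℚ.- q ∣ ‖ q ‖ℚ)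
    (∣-∣-triangle p q (fromℤ (round q))))

∣-∣-lipschitz : ∀ p q → ∣ ∣ p ∣ ℚ.- ∣ q ∣ ∣ ℚ.≤ ∣ p ℚ.- q ∣
∣-∣-lipschitz = lipschitz ∣_∣ λ p q → subst (ℚ._≤ ∣ q ∣ ℚ.+ ∣ p ℚ.- q ∣)
  (cong ∣_∣ (solve 2 (λ x y → y :+ (x :- y) := x) refl p q))
  (ℚ.∣p+q∣≤∣p∣+∣q∣ q (p ℚ.- q))

record ℝ : Set where
  constructor mkℝ
  field
    seq    : ℕ → ℚ
    cauchy : ∀ ε → 0ℚ ℚ.< ε → ∃ λ K → ∀ m n → K ℕ.≤ m → K ℕ.≤ n →
             ∣ seq m ℚ.- seq n ∣ ℚ.≤ ε

open ℝ public

infix 4 _≤ᴿ_ _<ᴿ_ _≈ᴿ_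

_≤ᴿ_ : ℝ → ℝ → Set
x ≤ᴿ y = ∀ ε → 0ℚ ℚ.< ε → ∃ λ K → ∀ n → K ℕ.≤ n → seq x n ℚ.≤ seq y n ℚ.+ ε

_<ᴿ_ : ℝ → ℝ → Set
x <ᴿ y = ∃ λ ε → 0ℚ ℚ.< ε × ∃ λ K → ∀ n → K ℕ.≤ n → seq x n ℚ.+ ε ℚ.≤ seq y n

_≈ᴿ_ : ℝ → ℝ → Set
x ≈ᴿ y = x ≤ᴿ y × y ≤ᴿ x

fromℚ : ℚ → ℝ
fromℚ q = mkℝ (λ _ → q) λ ε 0<ε → 0 , λ _ _ _ _ →
  subst (ℚ._≤ ε) (sym (cong ∣_∣ (ℚ.+-inverseʳ q))) (ℚ.<⇒≤ 0<ε)

lift : (f : ℚ → ℚ) → (∀ p q → ∣ f p ℚ.- f q ∣ ℚ.≤ ∣ p ℚ.- q ∣) → ℝ → ℝ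
lift f lip x = mkℝ (f ∘ seq x) λ ε 0<ε → let K , h = cauchy x ε 0<ε in
  K , λ m n K≤m K≤n → ℚ.≤-trans (lip (seq x m) (seq x n)) (h m n K≤m K≤n)

infixl 6 _-ᴿ_
infixr 7 _·_

_-ᴿ_ : ℝ → ℝ → ℝ
x -ᴿ y = mkℝ (λ n → seq x n ℚ.- seq y n) λ ε 0<ε →
  let K , h = cauchy x (½ ℚ.* ε) (half-pos 0<ε)
      L , k = cauchy y (½ ℚ.* ε) (half-pos 0<ε)
  in K ℕ.⊔ L , λ m n K⊔L≤m K⊔L≤n → subst₂ ℚ._≤_
    (cong ∣_∣ (solve 4 (λ a b c d → (a :- b) :- (c :- d) := (a :- c) :- (b :- d)) refl
      (seq x m) (seq x n) (seq y m) (seq y n)))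
    (half+half ε)
    (ℚ.≤-trans (ℚ.∣p-q∣≤∣p∣+∣q∣ (seq x m ℚ.- seq x n) (seq y m ℚ.- seq y n))
      (ℚ.+-mono-≤ (h m n (ℕ.m⊔n≤o⇒m≤o K L K⊔L≤m) (ℕ.m⊔n≤o⇒m≤o K L K⊔L≤n))
                  (k m n (ℕ.m⊔n≤o⇒n≤o K L K⊔L≤m) (ℕ.m⊔n≤o⇒n≤o K L K⊔L≤n))))

_·_ : ℚ → ℝ → ℝ
q · x = mkℝ (λ n → q ℚ.* seq x n) λ ε 0<ε →
  let K , h = cauchy x (1/r ℚ.* ε) (1/r*ε-pos 0<ε)
  in K , λ m n K≤m K≤n → subst (ℚ._≤ ε) (eq (seq x m) (seq x n)) (ℚ.≤-trans
    (ℚ.≤-trans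
      (ℚ.*-monoʳ-≤-nonNeg ∣ seq x m ℚ.- seq x n ∣ {{ℚ.∣-∣-nonNeg (seq x m ℚ.- seq x n)}} ∣q∣≤r)
      (ℚ.*-monoˡ-≤-nonNeg r {{ℚ.pos⇒nonNeg r}} (h m n K≤m K≤n)))
    (ℚ.≤-reflexive (r*1/r*ε ε)))
  where
  r = 1ℚ ℚ.+ ∣ q ∣
  instance
    r-pos : ℚ.Positive r
    r-pos = ℚ.pos+nonNeg⇒pos 1ℚ ∣ q ∣ {{ℚ.∣-∣-nonNeg q}}
    r-nonZero : ℚ.NonZero r
    r-nonZero = ℚ.pos⇒nonZero r
  1/r = ℚ.1/ r
  1/r*ε-pos : ∀ {ε} → 0ℚ ℚ.< ε → 0ℚ ℚ.< 1/r ℚ.* ε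
  1/r*ε-pos {ε} 0<ε = subst (ℚ._< 1/r ℚ.* ε) (ℚ.*-zeroʳ 1/r)
    (ℚ.*-monoʳ-<-pos 1/r {{ℚ.1/pos⇒pos r}} 0<ε)
  ∣q∣≤r : ∣ q ∣ ℚ.≤ r
  ∣q∣≤r = subst (ℚ._≤ r) (ℚ.+-identityˡ ∣ q ∣) (ℚ.+-monoˡ-≤ ∣ q ∣ (ℚ.<⇒≤ (ℚ.positive⁻¹ 1ℚ)))
  r*1/r*ε : ∀ ε → r ℚ.* (1/r ℚ.* ε) ≡ ε
  r*1/r*ε ε = trans (sym (ℚ.*-assoc r 1/r ε))
    (trans (cong (ℚ._* ε) (ℚ.*-inverseʳ r)) (ℚ.*-identityˡ ε))
  eq : ∀ a b → ∣ q ∣ ℚ.* ∣ a ℚ.- b ∣ ≡ ∣ q ℚ.* a ℚ.- q ℚ.* b ∣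
  eq a b = trans (sym (ℚ.∣p*q∣≡∣p∣*∣q∣ q (a ℚ.- b)))
    (cong ∣_∣ (solve 3 (λ q a b → q :* (a :- b) := q :* a :- q :* b) refl q a b))

∣_∣ᴿ : ℝ → ℝ
∣_∣ᴿ = lift ∣_∣ ∣-∣-lipschitz

‖_‖ : ℝ → ℝ
‖_‖ = lift ‖_‖ℚ ‖-‖ℚ-lipschitz

-- y = {x}; a relation, since {_} is discontinuous and so cannot be defined
-- constructively as a total function on ℝ.
IsFractionalPart : ℝ → ℝ → Set
IsFractionalPart x y =
  fromℚ 0ℚ ≤ᴿ y × y <ᴿ fromℚ 1ℚ × ∃ λ (k : ℤ) → x -ᴿ y ≈ᴿ fromℚ (fromℤ k)

HasCardinality : {A : Set} → Pred A 0ℓ → ℕ → Set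
HasCardinality P c = ∃ λ ps → Unique ps × length ps ≡ c × (∀ p → p ∈ ps ⇔ P p)

ClosePair : (ℕ → ℝ) → ℝ → (N : ℕ) .{{_ : ℕ.NonZero N}} → Pred (ℕ × ℕ) 0ℓ
ClosePair x s N (l , m) =
  (1 ℕ.≤ l × l ℕ.≤ N) × (1 ℕ.≤ m × m ℕ.≤ N) × l ≢ m ×
  ‖ x l -ᴿ x m ‖ ≤ᴿ ((+ 1) ℚ./ N) · s

-- The order on ℝ is undecidable, so the number c of close pairs in
-- F_N(s) = c / N is given by a relation rather than computed.  Such a c is
-- unique and its existence is not refutable, so classically ∀ c and ∃ c agree
-- here; ∀ c is the weaker property, hence has the stronger negation.
-- Only the terms x 1, …, x N occur.
HasPoissonianPairCorrelations : (ℕ → ℝ) → Set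
HasPoissonianPairCorrelations x =
  ∀ s → fromℚ 0ℚ ≤ᴿ s →
  ∀ ε → 0ℚ ℚ.< ε → ∃ λ N₀ →
  ∀ N .{{_ : ℕ.NonZero N}} → N₀ ℕ.≤ N →
  ∀ c → HasCardinality (ClosePair x s N) c →
  ∣ fromℚ ((+ c) ℚ./ N) -ᴿ fromℤ (+ 2) · s ∣ᴿ ≤ᴿ fromℚ ε

OccursAt : {A : Set} → List A → List A → ℕ → Set
OccursAt u w i = ∃₂ λ p s → length p ≡ i × w ≡ p ++ u ++ s

IsDeBruijnWord : (b m : ℕ) → List (Fin b) → Set
IsDeBruijnWord b m w =
  length w ≡ b ℕ.^ m ℕ.+ m ℕ.∸ 1 ×
  (∀ (u : List (Fin b)) → length u ≡ m → ∃! _≡_ (OccursAt u w))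

-- An infinite word a₁a₂a₃… is the function a with a k = aₖ₊₁.
IsInfiniteDeBruijnWord : (b : ℕ) → (ℕ → Fin b) → Set
IsInfiniteDeBruijnWord b a =
  (3 ℕ.≤ b → ∀ m → 1 ℕ.≤ m → PrefixIsDeBruijn m) ×
  (b ≡ 2 → ∀ m → ¬ 2 ∣ m → PrefixIsDeBruijn m)
  where
  PrefixIsDeBruijn : ℕ → Set
  PrefixIsDeBruijn m = IsDeBruijnWord b m (applyUpTo a (b ℕ.^ m ℕ.+ m ℕ.∸ 1))

module _ (b : ℕ) .{{_ : NonTrivial b}} where

  b^n≢0 : ∀ n → ℕ.NonZero (b ℕ.^ n)
  b^n≢0 n = ℕ.m^n≢0 b n {{ℕ.nonTrivial⇒nonZero b}}

  infixl 7 _/b^_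

  _/b^_ : ℕ → ℕ → ℚ
  d /b^ n = ((+ d) ℚ./ (b ℕ.^ n)) {{b^n≢0 n}}

  partialSum : (ℕ → Fin b) → ℕ → ℚ
  partialSum a zero    = 0ℚ
  partialSum a (suc n) = partialSum a n ℚ.+ toℕ (a n) /b^ suc n

  0≤d/b^n : ∀ d n → 0ℚ ℚ.≤ d /b^ n
  0≤d/b^n d n = /-mono-≤ (+ 0) 1 (+ d) (b ℕ.^ n) {{_}} {{b^n≢0 n}}
    (subst (+ 0 ℤ.≤_) (sym (ℤ.*-identityʳ (+ d))) (ℤ.+≤+ ℕ.z≤n))

  p≤p+d/b^n : ∀ p d n → p ℚ.≤ p ℚ.+ d /b^ n
  p≤p+d/b^n p d n = subst (ℚ._≤ p ℚ.+ d /b^ n) (ℚ.+-identityʳ p) (ℚ.+-monoʳ-≤ p (0≤d/b^n d n))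

  partialSum-mono : ∀ a {m n} → m ℕ.≤ n → partialSum a m ℚ.≤ partialSum a n
  partialSum-mono a = go ∘ ℕ.≤⇒≤′
    where
    go : ∀ {m n} → m ℕ.≤′ n → partialSum a m ℚ.≤ partialSum a n
    go ℕ.≤′-refl            = ℚ.≤-refl
    go (ℕ.≤′-step {n} m≤′n) =
      ℚ.≤-trans (go m≤′n) (p≤p+d/b^n (partialSum a n) (toℕ (a n)) (suc n))

  upperSum : (ℕ → Fin b) → ℕ → ℚ
  upperSum a n = partialSum a n ℚ.+ 1 /b^ n

  upperSum-antimono : ∀ a {m n} → m ℕ.≤ n → upperSum a n ℚ.≤ upperSum a m
  upperSum-antimono a = go ∘ ℕ.≤⇒≤′
    where
    step : ∀ n → upperSum a (suc n) ℚ.≤ upperSum a n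
    step n = subst (ℚ._≤ upperSum a n)
      (trans (cong (partialSum a n ℚ.+_)
               (sym (/-+ (+ d) (+ 1) (b ℕ.^ suc n) {{b^n≢0 (suc n)}})))
        (sym (ℚ.+-assoc (partialSum a n) (d /b^ suc n) (1 /b^ suc n))))
      (ℚ.+-monoʳ-≤ (partialSum a n)
        (/-mono-≤ (+ (d ℕ.+ 1)) (b ℕ.^ suc n) (+ 1) (b ℕ.^ n) {{b^n≢0 (suc n)}} {{b^n≢0 n}}
          (subst₂ ℤ._≤_ (ℤ.pos-* (d ℕ.+ 1) (b ℕ.^ n)) (ℤ.pos-* 1 (b ℕ.^ suc n))
            (ℤ.+≤+ (ℕ.≤-trans (ℕ.*-monoˡ-≤ (b ℕ.^ n) d+1≤b)
              (ℕ.≤-reflexive (sym (ℕ.*-identityˡ (b ℕ.^ suc n)))))))))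
      where
      d = toℕ (a n)
      d+1≤b : d ℕ.+ 1 ℕ.≤ b
      d+1≤b = subst (ℕ._≤ b) (ℕ.+-comm 1 d) (Fin.toℕ<n (a n))
    go : ∀ {m n} → m ℕ.≤′ n → upperSum a n ℚ.≤ upperSum a m
    go ℕ.≤′-refl            = ℚ.≤-refl
    go (ℕ.≤′-step {n} m≤′n) = ℚ.≤-trans (step n) (go m≤′n)

  n≤b^n : ∀ n → n ℕ.≤ b ℕ.^ n
  n≤b^n n = ℕ.<⇒≤ (n<b^n n)
    where
    n<b^n : ∀ n → n ℕ.< b ℕ.^ n
    n<b^n zero    = ℕ.z<s
    n<b^n (suc n) = ℕ.<-≤-trans (ℕ.+-mono-≤-< (ℕ.m^n>0 b {{ℕ.nonTrivial⇒nonZero b}} n) (n<b^n n))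
      (subst (ℕ._≤ b ℕ.^ suc n) (cong (b ℕ.^ n ℕ.+_) (ℕ.+-identityʳ (b ℕ.^ n)))
        (ℕ.*-monoˡ-≤ (b ℕ.^ n) (ℕ.nonTrivial⇒n>1 b)))

  1/b^↧ε≤ε : ∀ ε → 0ℚ ℚ.< ε → 1 /b^ ℚ.↧ₙ ε ℚ.≤ ε
  1/b^↧ε≤ε ε@(ℚ.mkℚ (+ suc n) d-1 _) _ = subst (1 /b^ suc d-1 ℚ.≤_) (ℚ.↥p/↧p≡p ε)
    (/-mono-≤ (+ 1) (b ℕ.^ suc d-1) (+ suc n) (suc d-1) {{b^n≢0 (suc d-1)}}
      (subst₂ ℤ._≤_ (ℤ.pos-* 1 (suc d-1)) (ℤ.pos-* (suc n) (b ℕ.^ suc d-1))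
        (ℤ.+≤+ (ℕ.*-mono-≤ {1} {suc n} (ℕ.s≤s ℕ.z≤n) (n≤b^n (suc d-1))))))
  1/b^↧ε≤ε (ℚ.mkℚ (+ zero) _ _)    (ℚ.*<* (ℤ.+<+ ()))
  1/b^↧ε≤ε (ℚ.mkℚ ℤ.-[1+ _ ] _ _) (ℚ.*<* ())

  -- Σ_{k ≥ 0} a k / b^(k+1): the first digit after the radix point is `a 0`.
  expansion : (ℕ → Fin b) → ℝ
  expansion a = mkℝ (partialSum a) λ ε 0<ε →
    let K = ℚ.↧ₙ ε
        close : ∀ m n → K ℕ.≤ m → K ℕ.≤ n → partialSum a m ℚ.- partialSum a n ℚ.≤ ε
        close m n K≤m K≤n = p≤q+r⇒p-q≤r (ℚ.≤-trans
          (ℚ.≤-trans (p≤p+d/b^n (partialSum a m) 1 m) (upperSum-antimono a K≤m))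
          (ℚ.+-mono-≤ (partialSum-mono a K≤n) (1/b^↧ε≤ε ε 0<ε)))
    in K , λ m n K≤m K≤n → ∣p∣≤ (close m n K≤m K≤n)
      (subst (ℚ._≤ ε)
        (solve 2 (λ x y → y :- x := :- (x :- y)) refl (partialSum a m) (partialSum a n))
        (close n m K≤n K≤m))

{-# OPTIONS --safe #-}

-- Take N = b^m - 1, with m odd.  The first b^m terms of ({b^n α}) lie one in each of the
-- b^m intervals [j/b^m, (j+1)/b^m), so almost every pair at distance below 1/N consists of
-- the points of two adjacent intervals.  Poissonian pair correlations for s close to 1
-- force almost all gaps between adjacent points to be at most 1/b^m, and for s close to
-- 1/b they force about N/b of these gaps to be at most 1/b^(m+1).  Then the gaps cannot
-- add up to 1.
--
-- All this is done with the integer parts of b^(m+5) {b^n α}; the truncation error costs 3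
-- units of length 1/b^(m+5), hence s = (b^5 - 3)/b^5 and s = (b^4 - 3)/b^5 below.
module Submission where

open import Defs
open import Data.Fin.Base using (Fin)
open import Data.Integer.Base using (+_)
open import Data.Nat.Base using (ℕ; NonTrivial; _^_)
open import Relation.Nullary using (¬_)

open import Data.Empty using (⊥)
open import Data.Fin.Base using (toℕ; fromℕ<; punchOut)
import Data.Fin.Properties as Fin
open import Data.Integer.Base as ℤ using (ℤ; -[1+_])
import Data.Integer.Properties as ℤ
import Data.Integer.Solver as ℤS
open import Data.List.Base
  using (List; []; _∷_; _++_; _∷ʳ_; length; applyUpTo)
open import Data.List.Membership.Propositional using (_∈_)
import Data.List.Membership.Propositional.Properties as List
import Data.List.Properties as List
open import Data.List.Relation.Binary.Subset.Propositional using (_⊆_)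
import Data.List.Relation.Unary.All as All
open import Data.List.Relation.Unary.AllPairs using ([]; _∷_)
open import Data.List.Relation.Unary.Any using (here; there)
open import Data.List.Relation.Unary.Unique.Propositional using (Unique)
import Data.List.Relation.Unary.Unique.Propositional.Properties as Unique
import Data.Nat.Base as ℕ
open import Data.Nat.Base using (zero; suc; NonZero; z≤n; s≤s)
open import Data.Nat.Divisibility using (_∣_; ∣m+n∣m⇒∣n; m∣m*n; ∣1⇒≡1)
open import Data.Nat.DivMod
  using (_%_; m%n<n; m<n⇒m%n≡m; m%n%n≡m%n; n%n≡0; [m+kn]%n≡m%n; %-distribˡ-+)
import Data.Nat.Properties as ℕ
import Data.Nat.Solver as ℕS
open import Data.Product.Base using (∃; ∃₂; _×_; _,_; proj₁; proj₂)
open import Data.Rational.Base as ℚ using (ℚ; 0ℚ; 1ℚ; ∣_∣; round)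
import Data.Rational.Properties as ℚ
import Data.Rational.Solver as ℚS
import Data.Rational.Unnormalised.Base as ℚᵘ
import Data.Rational.Unnormalised.Properties as ℚᵘ
open import Data.Sum.Base using (_⊎_; inj₁; inj₂; swap)
open import Function.Base using (_∘_)
open import Function.Bundles using (_⇔_; mk⇔; Equivalence)
open import Function.Definitions using (Injective)
open import Level using (0ℓ)
open import Relation.Binary.Definitions using (tri<; tri≈; tri>)
open import Relation.Binary.PropositionalEquality
  using (_≡_; _≢_; refl; sym; trans; cong; cong₂; subst; subst₂; ≢-sym; module ≡-Reasoning)
open import Relation.Nullary using (Dec; yes; no; contradiction)
open import Relation.Nullary.Decidable using (¬¬-excluded-middle)
open import Relation.Unary using (Pred)

-- Gaps on a discrete circle

module _ where
  open import Data.Nat.Base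
  open import Data.Nat.Properties
  open ℕS.+-*-Solver

  module _ {A : Set} where

    ∈-remove : ∀ {x y : A} ys {zs} → x ∈ ys ++ y ∷ zs → x ≢ y → x ∈ ys ++ zs
    ∈-remove ys x∈ x≢y with List.∈-++⁻ ys x∈
    ... | inj₁ x∈ys         = List.∈-++⁺ˡ x∈ys
    ... | inj₂ (here x≡y)   = contradiction x≡y x≢y
    ... | inj₂ (there x∈zs) = List.∈-++⁺ʳ ys x∈zs

    Unique-⊆⇒length≤ : ∀ {xs ys : List A} → Unique xs → xs ⊆ ys → length xs ≤ length ys
    Unique-⊆⇒length≤ []            _     = z≤n
    Unique-⊆⇒length≤ (x∉xs ∷ u) xs⊆ys with List.∈-∃++ (xs⊆ys (here refl))
    ... | as , bs , refl = ≤-trans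
      (s≤s (Unique-⊆⇒length≤ u λ y∈xs →
        ∈-remove as (xs⊆ys (there y∈xs)) (≢-sym (All.lookup x∉xs y∈xs))))
      (≤-reflexive (trans (cong suc (List.length-++ as))
        (trans (sym (+-suc (length as) (length bs))) (sym (List.length-++ as)))))

  -- If `y` were missed, `punchOut` at `y` would embed `Fin (suc n)` into `Fin n`.
  injective⇒surjective : ∀ {n} {f : Fin n → Fin n} → Injective _≡_ _≡_ f → ∀ y → ∃ λ x → f x ≡ y
  injective⇒surjective {suc n} {f} f-inj y with Fin.any? (λ x → f x Fin.≟ y)
  ... | yes x = x
  ... | no ¬x = contradiction
    (Fin.injective⇒≤ {f = λ x → punchOut (y≢f x)}
      (λ {i} {j} eq → f-inj (Fin.punchOut-injective (y≢f i) (y≢f j) eq)))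
    1+n≰n
    where
    y≢f : ∀ x → y ≢ f x
    y≢f x y≡fx = ¬x (x , sym y≡fx)

  %-cong-suc : ∀ {x y} M .{{_ : NonZero M}} → x % M ≡ y % M → suc x % M ≡ suc y % M
  %-cong-suc {x} {y} M eq = trans (%-distribˡ-+ 1 x M)
    (trans (cong (λ r → (1 % M + r) % M) eq) (sym (%-distribˡ-+ 1 y M)))

  -- Moving forward by at most one cell width crosses at most one cell boundary: as both offsets are
  -- below `Q`, the two sides cannot agree when `c′ < c` or `c′ ≥ c + 2`.
  quotients-near : ∀ {Q c c′ v v′ d} → v < Q → v′ < Q → d ≤ Q → c′ * Q + v′ ≡ c * Q + v + d →
                   c′ ≡ c ⊎ c′ ≡ suc c × v′ + Q ≡ v + d
  quotients-near {Q} {c} {c′} {v} {v′} {d} v<Q v′<Q d≤Q eq with <-cmp c′ c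
  ... | tri≈ _ c′≡c _ = inj₁ c′≡c
  ... | tri< c′<c _ _ = contradiction eq (<⇒≢ (begin-strict
    c′ * Q + v′   <⟨ +-monoʳ-< (c′ * Q) v′<Q ⟩
    c′ * Q + Q    ≡⟨ +-comm (c′ * Q) Q ⟩
    suc c′ * Q    ≤⟨ *-monoˡ-≤ Q c′<c ⟩
    c * Q         ≤⟨ m≤m+n (c * Q) (v + d) ⟩
    c * Q + (v + d) ≡⟨ +-assoc (c * Q) v d ⟨
    c * Q + v + d ∎))
    where open ≤-Reasoning
  ... | tri> _ _ c<c′ with m≤n⇒m<n∨m≡n c<c′
  ...   | inj₂ refl = inj₂ (refl , +-cancelˡ-≡ (c * Q) _ _
    (trans (solve 3 (λ c q v → c :* q :+ (v :+ q) := (con 1 :+ c) :* q :+ v) refl c Q v′)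
      (trans eq (+-assoc (c * Q) v d))))
  ...   | inj₁ 2+c≤c′ = contradiction (sym eq) (<⇒≢ (begin-strict
    c * Q + v + d     <⟨ +-mono-<-≤ (+-monoʳ-< (c * Q) v<Q) d≤Q ⟩
    c * Q + Q + Q     ≡⟨ solve 2 (λ c q → c :* q :+ q :+ q := (con 2 :+ c) :* q) refl c Q ⟩
    suc (suc c) * Q   ≤⟨ *-monoˡ-≤ Q 2+c≤c′ ⟩
    c′ * Q            ≤⟨ m≤m+n (c′ * Q) v′ ⟩
    c′ * Q + v′       ∎))
    where open ≤-Reasoning

  -- One induction step of `telescope`. For consecutive offsets `x` and `y` the gap is `Q + y − x`,
  -- which the last hypothesis bounds by `2 Q − g`; the sum `s` collects the doubled savings `g`.
  add-step : ∀ Q x y {z s} g n → 2 * x + s ≤ z + n * (2 * Q) → y + g ≤ x + Q →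
             2 * y + (2 * g + s) ≤ z + suc n * (2 * Q)
  add-step Q x y {z} {s} g n total step = begin
    2 * y + (2 * g + s)   ≡⟨ solve 3 (λ y g s → con 2 :* y :+ (con 2 :* g :+ s) :=
                                                 con 2 :* (y :+ g) :+ s) refl y g s ⟩
    2 * (y + g) + s       ≤⟨ +-monoˡ-≤ s (*-monoʳ-≤ 2 step) ⟩
    2 * (x + Q) + s       ≡⟨ solve 3 (λ x q s → con 2 :* (x :+ q) :+ s :=
                                                 (con 2 :* x :+ s) :+ con 2 :* q) refl x Q s ⟩
    2 * x + s + 2 * Q     ≤⟨ +-monoˡ-≤ (2 * Q) total ⟩
    z + n * (2 * Q) + 2 * Q ≡⟨ solve 3 (λ z n q → z :+ n :* q :+ q := z :+ (con 1 :+ n) :* q)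
                                   refl z n (2 * Q) ⟩
    z + suc n * (2 * Q)   ∎
    where open ≤-Reasoning

  Near : (W H x y : ℕ) → Set
  Near W H x y = ∃ λ k → x ≤ y + k * W + H × y + k * W ≤ x + H

  -- On the circle ℤ/W, y lies at a distance d ≤ H after x.
  Follows : (W H x y : ℕ) → Set
  Follows W H x y = ∃ λ d → d ≤ H × ∃₂ λ k k′ → y + k * W ≡ x + k′ * W + d

  near⇒follows : ∀ {W H x y} → Near W H x y → Follows W H x y ⊎ Follows W H y x
  near⇒follows {W} {H} {x} {y} (k , x≤ , y≤) with ≤-total x (y + k * W)
  ... | inj₁ x≤y = inj₁ (y + k * W ∸ x , m≤n+o⇒m∸n≤o (y + k * W) x y≤ , k , 0 ,
    sym (trans (cong (_+ (y + k * W ∸ x)) (+-identityʳ x)) (m+[n∸m]≡n x≤y)))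
  ... | inj₂ y≤x = inj₂ (x ∸ (y + k * W) , m≤n+o⇒m∸n≤o x (y + k * W) x≤ , 0 , k ,
    trans (+-identityʳ x) (sym (m+[n∸m]≡n y≤x)))

  -- The point l < M lies at C l * Q + V l on a circle divided into M cells of width Q,
  -- with exactly one point in each cell.
  module Cells (M Q : ℕ) .{{_ : NonZero M}} (C V : ℕ → ℕ) (V<Q : ∀ n → V n < Q)
               (C-injective : ∀ {l m} → l < M → m < M → C l % M ≡ C m % M → l ≡ m) where

    private
      cell : Fin M → Fin M
      cell i = fromℕ< (m%n<n (C (toℕ i)) M)

      cell-injective : Injective _≡_ _≡_ cell
      cell-injective {i} {j} eq = Fin.toℕ-injective
        (C-injective (Fin.toℕ<n i) (Fin.toℕ<n j) (Fin.fromℕ<-injective _ _ _ _ eq))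

      -- Distinct points lie in distinct cells, and there are as many points as cells, so no cell is
      -- empty.
      occupant : ∀ j → ∃ λ i → cell i ≡ fromℕ< (m%n<n j M)
      occupant j = injective⇒surjective cell-injective (fromℕ< (m%n<n j M))

    -- The index `j` is read modulo `M`, so that the cell after the last one is the first one.
    point : ℕ → ℕ
    point j = toℕ (proj₁ (occupant j))

    C-point : ∀ j → C (point j) % M ≡ j % M
    C-point j = Fin.fromℕ<-injective _ _ _ _ (proj₂ (occupant j))

    point-unique : ∀ {l} j → l < M → C l % M ≡ j % M → point j ≡ l
    point-unique j l<M eq =
      C-injective (Fin.toℕ<n (proj₁ (occupant j))) l<M (trans (C-point j) (sym eq))

    offset : ℕ → ℕ
    offset j = V (point j)

    -- Going once around returns to the starting point; this cancels the boundary terms of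
    -- `telescope` in `links-bound`.
    offset-M≡offset-0 : offset M ≡ offset 0
    offset-M≡offset-0 = cong V (point-unique M (Fin.toℕ<n (proj₁ (occupant 0)))
      (trans (C-point 0) (trans (m<n⇒m%n≡m (>-nonZero⁻¹ M)) (sym (n%n≡0 M)))))

    Linked : ℕ → ℕ → Set
    Linked H j = offset (suc j) + Q ≤ offset j + H

    linked? : ∀ H j → Dec (Linked H j)
    linked? H j = offset (suc j) + Q ≤? offset j + H

    -- Since `H ≤ Q`, the later point lies in the same cell or in the next one, by `quotients-near`;
    -- the same cell would force `l ≡ m`.
    follows⇒linked : ∀ {H l m} → H ≤ Q → l < M → m < M → l ≢ m →
                     Follows (M * Q) H (C l * Q + V l) (C m * Q + V m) →
                     ∃ λ j → j < M × Linked H j × point j ≡ l × point (suc j) ≡ m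
    follows⇒linked {H} {l} {m} H≤Q l<M m<M l≢m (d , d≤H , k , k′ , eq)
      -- A full turn `M * Q` is `M` cells, so the turns are absorbed into the cell numbers, which
      -- matter only modulo `M`.
      with quotients-near {Q} {C l + k′ * M} {C m + k * M} (V<Q l) (V<Q m) (≤-trans d≤H H≤Q)
        (trans (solve 5 (λ c q v k M → (c :+ k :* M) :* q :+ v := c :* q :+ v :+ k :* (M :* q))
                  refl (C m) Q (V m) k M)
          (trans eq (cong (_+ d)
            (solve 5 (λ c q v k M → c :* q :+ v :+ k :* (M :* q) := (c :+ k :* M) :* q :+ v)
                  refl (C l) Q (V l) k′ M))))
    ... | inj₁ same = contradiction
      (C-injective l<M m<M (trans (sym ([m+kn]%n≡m%n (C l) k′ M))
        (trans (cong (_% M) (sym same)) ([m+kn]%n≡m%n (C m) k M))))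
      l≢m
    ... | inj₂ (next , offsets) = j , m%n<n (C l) M ,
      subst₂ (λ x y → V y + Q ≤ V x + H) (sym pj≡l) (sym psj≡m)
        (≤-trans (≤-reflexive offsets) (+-monoʳ-≤ (V l) d≤H)) ,
      pj≡l , psj≡m
      where
      j = C l % M
      pj≡l : point j ≡ l
      pj≡l = point-unique j l<M (sym (m%n%n≡m%n (C l) M))
      psj≡m : point (suc j) ≡ m
      psj≡m = point-unique (suc j) m<M (trans (sym ([m+kn]%n≡m%n (C m) k M))
        (trans (cong (_% M) next) (trans ([m+kn]%n≡m%n (suc (C l)) k′ M)
          (%-cong-suc M (sym (m%n%n≡m%n (C l) M))))))

    links : ℕ → ℕ → List (ℕ × ℕ)
    links H zero    = []
    links H (suc n) with linked? H n
    ... | yes _ = (point n , point (suc n)) ∷ (point (suc n) , point n) ∷ links H n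
    ... | no  _ = links H n

    ∈-links : ∀ {H n j} → j < n → Linked H j →
              (point j , point (suc j)) ∈ links H n × (point (suc j) , point j) ∈ links H n
    ∈-links {H} {suc n} {j} j<n linked with linked? H n | m≤n⇒m<n∨m≡n (≤-pred j<n)
    ... | yes _ | inj₂ refl = here refl , there (here refl)
    ... | no ¬l | inj₂ refl = contradiction linked ¬l
    ... | no _  | inj₁ j<n′ = ∈-links j<n′ linked
    ... | yes _ | inj₁ j<n′ with ∈-links j<n′ linked
    ...   | here₁ , here₂ = there (there here₁) , there (there here₂)

    follows⇒∈-links : ∀ {H l m} → H ≤ Q → l < M → m < M → l ≢ m →
                   Follows (M * Q) H (C l * Q + V l) (C m * Q + V m) ⊎
                   Follows (M * Q) H (C m * Q + V m) (C l * Q + V l) →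
                   (l , m) ∈ links H M
    follows⇒∈-links H≤Q l<M m<M l≢m (inj₁ fol) with follows⇒linked H≤Q l<M m<M l≢m fol
    ... | j , j<M , linked , refl , refl = proj₁ (∈-links j<M linked)
    follows⇒∈-links H≤Q l<M m<M l≢m (inj₂ fol) with follows⇒linked H≤Q m<M l<M (≢-sym l≢m) fol
    ... | j , j<M , linked , refl , refl = proj₂ (∈-links j<M linked)

    -- The gaps between consecutive points add up to the circumference M Q.  A gap is less
    -- than 2 Q, at most Q if linked for Q, and at most Q − D if linked for H; the factor 2
    -- is there because links lists both orders of a pair.
    telescope : ∀ {H D} → H + D ≡ Q → ∀ n →
                2 * offset n + (Q * length (links Q n) + D * length (links H n)) ≤
                2 * offset 0 + n * (2 * Q)
    telescope {H} {D} H+D≡Q zero = ≤-reflexive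
      (cong (λ s → 2 * offset 0 + s) (cong₂ _+_ (*-zeroʳ Q) (*-zeroʳ D)))
    telescope {H} {D} H+D≡Q (suc n) with telescope {H} {D} H+D≡Q n | linked? Q n | linked? H n
    ... | ih | yes lQ | yes lH = ≤-trans
      (≤-reflexive (solve 5 (λ v q d e f →
        con 2 :* v :+ (q :* (con 2 :+ e) :+ d :* (con 2 :+ f)) :=
        con 2 :* v :+ (con 2 :* (q :+ d) :+ (q :* e :+ d :* f)))
        refl (offset (suc n)) Q D (length (links Q n)) (length (links H n))))
      (add-step Q (offset n) (offset (suc n)) (Q + D) n ih
        (subst (λ h → offset (suc n) + (Q + D) ≤ offset n + h) H+D≡Q
          (subst₂ _≤_ (+-assoc _ Q D) (+-assoc (offset n) H D) (+-monoˡ-≤ D lH))))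
    ... | ih | yes lQ | no _ = ≤-trans
      (≤-reflexive (solve 5 (λ v q d e f →
        con 2 :* v :+ (q :* (con 2 :+ e) :+ d :* f) :=
        con 2 :* v :+ (con 2 :* q :+ (q :* e :+ d :* f)))
        refl (offset (suc n)) Q D (length (links Q n)) (length (links H n))))
      (add-step Q (offset n) (offset (suc n)) Q n ih lQ)
    ... | ih | no _ | no _ = add-step Q (offset n) (offset (suc n)) 0 n ih
      (≤-trans (≤-reflexive (+-identityʳ _)) (≤-trans (<⇒≤ (V<Q _)) (m≤n+m Q (offset n))))
    ... | ih | no ¬lQ | yes lH = contradiction
      (≤-trans lH (+-monoʳ-≤ (offset n) (subst (H ≤_) H+D≡Q (m≤m+n H D)))) ¬lQ

    links-bound : ∀ {H D} → H + D ≡ Q →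
                  Q * length (links Q M) + D * length (links H M) ≤ M * (2 * Q)
    links-bound {H} {D} H+D≡Q = +-cancelˡ-≤ (2 * offset 0) _ _
      (subst (λ v → 2 * v + (Q * length (links Q M) + D * length (links H M)) ≤
                    2 * offset 0 + M * (2 * Q))
        offset-M≡offset-0 (telescope {H} {D} H+D≡Q M))

-- Rational approximations

fromℕ : ℕ → ℚ
fromℕ n = fromℤ (+ n)

fromℤ-+ : ∀ i j → fromℤ (i ℤ.+ j) ≡ fromℤ i ℚ.+ fromℤ j
fromℤ-+ i j = sym (/-+ i j 1)

toℚᵘ-/ : ∀ i n .{{_ : NonZero n}} → ℚ.toℚᵘ (i ℚ./ n) ℚᵘ.≃ i ℚᵘ./ n
toℚᵘ-/ i (suc n-1) = ℚ.toℚᵘ-fromℚᵘ (ℚᵘ.mkℚᵘ i n-1)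

fromℤ-* : ∀ i j → fromℤ (i ℤ.* j) ≡ fromℤ i ℚ.* fromℤ j
fromℤ-* i j = ℚ.toℚᵘ-injective (ℚᵘ.≃-trans (toℚᵘ-/ (i ℤ.* j) 1)
  (ℚᵘ.≃-sym (ℚᵘ.≃-trans (ℚ.toℚᵘ-homo-* (fromℤ i) (fromℤ j))
    (ℚᵘ.*-cong (toℚᵘ-/ i 1) (toℚᵘ-/ j 1)))))

fromℕ-+ : ∀ m n → fromℕ (m ℕ.+ n) ≡ fromℕ m ℚ.+ fromℕ n
fromℕ-+ m n = fromℤ-+ (+ m) (+ n)

fromℕ-* : ∀ m n → fromℕ (m ℕ.* n) ≡ fromℕ m ℚ.* fromℕ n
fromℕ-* m n = trans (cong fromℤ (ℤ.pos-* m n)) (fromℤ-* (+ m) (+ n))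

fromℕ-mono-≤ : ∀ {m n} → m ℕ.≤ n → fromℕ m ℚ.≤ fromℕ n
fromℕ-mono-≤ m≤n = fromℤ-mono-≤ (ℤ.+≤+ m≤n)

fromℤ-cancel-≤ : ∀ {i j} → fromℤ i ℚ.≤ fromℤ j → i ℤ.≤ j
fromℤ-cancel-≤ {i} {j} i≤j
  with ℚᵘ.≤-respˡ-≃ (toℚᵘ-/ i 1) (ℚᵘ.≤-respʳ-≃ (toℚᵘ-/ j 1) (ℚ.toℚᵘ-mono-≤ i≤j))
... | ℚᵘ.*≤* h = subst₂ ℤ._≤_ (ℤ.*-identityʳ i) (ℤ.*-identityʳ j) h

fromℕ-cancel-≤ : ∀ {m n} → fromℕ m ℚ.≤ fromℕ n → m ℕ.≤ n
fromℕ-cancel-≤ m≤n = ℤ.drop‿+≤+ (fromℤ-cancel-≤ m≤n)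

fromℕ-nonNeg : ∀ n → ℚ.NonNegative (fromℕ n)
fromℕ-nonNeg n = ℚ.nonNegative (fromℕ-mono-≤ {0} {n} z≤n)

/-cancel : ∀ i n .{{_ : NonZero n}} → fromℕ n ℚ.* (i ℚ./ n) ≡ fromℤ i
/-cancel i n@(suc n-1) = ℚ.toℚᵘ-injective (ℚᵘ.≃-trans (ℚ.toℚᵘ-homo-* (fromℕ n) (i ℚ./ n))
  (ℚᵘ.≃-trans (ℚᵘ.*-cong (toℚᵘ-/ (+ n) 1) (toℚᵘ-/ i n))
    (ℚᵘ.≃-trans (ℚᵘ.*≡* (eq i (+ n))) (ℚᵘ.≃-sym (toℚᵘ-/ i 1)))))
  where
  module S = ℤS.+-*-Solver
  eq : ∀ i n → (n ℤ.* i) ℤ.* + 1 ≡ i ℤ.* (+ 1 ℤ.* n)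
  eq = S.solve 2 (λ i n → (n S.:* i) S.:* S.con (+ 1) S.:= i S.:* (S.con (+ 1) S.:* n)) refl

1/n-pos : ∀ n .{{_ : NonZero n}} → 0ℚ ℚ.< (+ 1) ℚ./ n
1/n-pos n = ℚ.positive⁻¹ _ {{ℚ.normalize-pos 1 n}}

fromℕ-*-mono-≤ : ∀ n {p q} → p ℚ.≤ q → fromℕ n ℚ.* p ℚ.≤ fromℕ n ℚ.* q
fromℕ-*-mono-≤ n = ℚ.*-monoˡ-≤-nonNeg (fromℕ n) {{fromℕ-nonNeg n}}

-- The number of turns `z` may be negative; it is then moved to the other point, which exchanges the
-- two points, whence the `swap`.
int-near⇒follows : ∀ {W H x y} z →
  + x ℤ.≤ + y ℤ.+ z ℤ.* + W ℤ.+ + H → + y ℤ.+ z ℤ.* + W ℤ.≤ + x ℤ.+ + H →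
  Follows W H x y ⊎ Follows W H y x
int-near⇒follows {W} {H} {x} {y} (+ k) x≤ y≤ = near⇒follows (k ,
  ℤ.drop‿+≤+ (subst (λ w → + x ℤ.≤ + y ℤ.+ w ℤ.+ + H) (sym (ℤ.pos-* k W)) x≤) ,
  ℤ.drop‿+≤+ (subst (λ w → + y ℤ.+ w ℤ.≤ + x ℤ.+ + H) (sym (ℤ.pos-* k W)) y≤))
int-near⇒follows {W} {H} {x} {y} z@(-[1+ k ]) x≤ y≤ = swap (near⇒follows (suc k ,
  ℤ.drop‿+≤+ (subst₂ ℤ._≤_ (eq₁ (+ y) z (+ W)) (trans (eq₂ (+ x) (+ H) z (+ W)) (kW x H))
     (ℤ.+-monoˡ-≤ (ℤ.- z ℤ.* + W) y≤)) ,
  ℤ.drop‿+≤+ (subst₂ ℤ._≤_ (kW′ x) (eq₃ (+ y) (+ H) z (+ W)) (ℤ.+-monoˡ-≤ (ℤ.- z ℤ.* + W) x≤))))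
  where
  module S = ℤS.+-*-Solver
  eq₁ : ∀ y z w → y ℤ.+ z ℤ.* w ℤ.+ ℤ.- z ℤ.* w ≡ y
  eq₁ = S.solve 3 (λ y z w → y S.:+ z S.:* w S.:+ (S.:- z) S.:* w S.:= y) refl
  eq₂ : ∀ x h z w → x ℤ.+ h ℤ.+ ℤ.- z ℤ.* w ≡ x ℤ.+ ℤ.- z ℤ.* w ℤ.+ h
  eq₂ = S.solve 4 (λ x h z w →
    x S.:+ h S.:+ (S.:- z) S.:* w S.:= x S.:+ (S.:- z) S.:* w S.:+ h) refl
  eq₃ : ∀ y h z w → y ℤ.+ z ℤ.* w ℤ.+ h ℤ.+ ℤ.- z ℤ.* w ≡ y ℤ.+ h
  eq₃ = S.solve 4 (λ y h z w → y S.:+ z S.:* w S.:+ h S.:+ (S.:- z) S.:* w S.:= y S.:+ h) refl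
  kW′ : ∀ x → + x ℤ.+ + suc k ℤ.* + W ≡ + (x ℕ.+ suc k ℕ.* W)
  kW′ x = cong (λ w → + x ℤ.+ w) (sym (ℤ.pos-* (suc k) W))
  kW : ∀ x H → + x ℤ.+ + suc k ℤ.* + W ℤ.+ + H ≡ + (x ℕ.+ suc k ℕ.* W ℕ.+ H)
  kW x H = cong (ℤ._+ + H) (kW′ x)

infixr 4 _∩_

_∩_ : ∀ {P Q : ℕ → Set} → (∃ λ K → ∀ n → K ℕ.≤ n → P n) → (∃ λ K → ∀ n → K ℕ.≤ n → Q n) →
      ∃ λ K → ∀ n → K ℕ.≤ n → P n × Q n
(K , p) ∩ (L , q) = K ℕ.⊔ L , λ n K⊔L≤n →
  p n (ℕ.m⊔n≤o⇒m≤o K L K⊔L≤n) , q n (ℕ.m⊔n≤o⇒n≤o K L K⊔L≤n)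

-- Here u and u′ are rational approximations to bˡα and bᵐα, which are x and y up to the
-- integers i and j, and X and X′ are the integer parts of W u and W u′.
compare-words : ∀ W u u′ X X′ x y ε σ i j r K →
  X ℚ.≤ W ℚ.* u → W ℚ.* u′ ℚ.≤ X′ ℚ.+ 1ℚ →
  u ℚ.- x ℚ.≤ i ℚ.+ ε → j ℚ.≤ u′ ℚ.- y ℚ.+ ε → x ℚ.- y ℚ.- r ℚ.≤ σ ℚ.+ ε →
  (∀ {p q} → p ℚ.≤ q → W ℚ.* p ℚ.≤ W ℚ.* q) →
  W ℚ.* σ ℚ.≤ K ℚ.+ 1ℚ → W ℚ.* (ε ℚ.+ ε ℚ.+ ε) ≡ 1ℚ →
  X ℚ.≤ X′ ℚ.+ (i ℚ.- j ℚ.+ r) ℚ.* W ℚ.+ (1ℚ ℚ.+ 1ℚ ℚ.+ 1ℚ ℚ.+ K)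
compare-words W u u′ X X′ x y ε σ i j r K h₁ h₂ h₃ h₄ h₅ mono hσ hε = begin
  X        ≤⟨ h₁ ⟩
  W ℚ.* u
    ≡⟨ cong (W ℚ.*_) (solve 5 (λ u x y j r →
         u := (u :- x) :+ j :+ (x :- y :- r) :+ (y :- j :+ r)) refl u x y j r) ⟩
  W ℚ.* ((u ℚ.- x) ℚ.+ j ℚ.+ (x ℚ.- y ℚ.- r) ℚ.+ (y ℚ.- j ℚ.+ r))
    ≤⟨ mono (ℚ.+-monoˡ-≤ (y ℚ.- j ℚ.+ r) (ℚ.+-mono-≤ (ℚ.+-mono-≤ h₃ h₄) h₅)) ⟩
  W ℚ.* ((i ℚ.+ ε) ℚ.+ (u′ ℚ.- y ℚ.+ ε) ℚ.+ (σ ℚ.+ ε) ℚ.+ (y ℚ.- j ℚ.+ r))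
    ≡⟨ solve 8 (λ w i ε u y σ j r →
         w :* ((i :+ ε) :+ (u :- y :+ ε) :+ (σ :+ ε) :+ (y :- j :+ r)) :=
         w :* u :+ (i :- j :+ r) :* w :+ w :* (ε :+ ε :+ ε) :+ w :* σ)
         refl W i ε u′ y σ j r ⟩
  W ℚ.* u′ ℚ.+ (i ℚ.- j ℚ.+ r) ℚ.* W ℚ.+ W ℚ.* (ε ℚ.+ ε ℚ.+ ε) ℚ.+ W ℚ.* σ
    ≤⟨ ℚ.+-mono-≤ (ℚ.+-mono-≤ (ℚ.+-monoˡ-≤ ((i ℚ.- j ℚ.+ r) ℚ.* W) h₂) (ℚ.≤-reflexive hε)) hσ ⟩
  X′ ℚ.+ 1ℚ ℚ.+ (i ℚ.- j ℚ.+ r) ℚ.* W ℚ.+ 1ℚ ℚ.+ (K ℚ.+ 1ℚ)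
    ≡⟨ solve 3 (λ x z k → x :+ con 1ℚ :+ z :+ con 1ℚ :+ (k :+ con 1ℚ) :=
         x :+ z :+ (con 1ℚ :+ con 1ℚ :+ con 1ℚ :+ k))
         refl X′ ((i ℚ.- j ℚ.+ r) ℚ.* W) K ⟩
  X′ ℚ.+ (i ℚ.- j ℚ.+ r) ℚ.* W ℚ.+ (1ℚ ℚ.+ 1ℚ ℚ.+ 1ℚ ℚ.+ K) ∎
  where
  open ℚ.≤-Reasoning
  open ℚS.+-*-Solver

-- The `ε` for which the three approximation errors in `compare-words` add up to one unit `1/W`.
third : ∀ W .{{_ : NonZero W}} → ∃ λ ε → 0ℚ ℚ.< ε × fromℕ W ℚ.* (ε ℚ.+ ε ℚ.+ ε) ≡ 1ℚ
third W = ε , 1/n-pos (3 ℕ.* W) , (begin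
  fromℕ W ℚ.* (ε ℚ.+ ε ℚ.+ ε)
    ≡⟨ solve 2 (λ w e → w :* (e :+ e :+ e) := con (fromℕ 3) :* w :* e) refl (fromℕ W) ε ⟩
  fromℕ 3 ℚ.* fromℕ W ℚ.* ε  ≡⟨ cong (ℚ._* ε) (fromℕ-* 3 W) ⟨
  fromℕ (3 ℕ.* W) ℚ.* ε      ≡⟨ /-cancel (+ 1) (3 ℕ.* W) ⟩
  1ℚ                         ∎)
  where
  open ℚS.+-*-Solver
  open ≡-Reasoning
  instance
    3W≢0 : NonZero (3 ℕ.* W)
    3W≢0 = ℕ.m*n≢0 3 W
  ε = (+ 1) ℚ./ (3 ℕ.* W)

-- The circle has circumference `(N + 1) Q` while the Poissonian scale is `1/N`; the product is
-- `K + K/N`, and `K ≤ N` makes the excess at most one unit.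
scaled-gap : ∀ {Q K N} .{{_ : NonZero Q}} .{{_ : NonZero N}} → K ℕ.≤ N →
             fromℕ (suc N ℕ.* Q) ℚ.* ((+ 1) ℚ./ N ℚ.* ((+ K) ℚ./ Q)) ℚ.≤ fromℕ K ℚ.+ 1ℚ
scaled-gap {Q} {K} {N} K≤N = begin
  fromℕ (suc N ℕ.* Q) ℚ.* (1/N ℚ.* K/Q)
    ≡⟨ cong (ℚ._* (1/N ℚ.* K/Q))
         (trans (fromℕ-* (suc N) Q) (cong (ℚ._* fromℕ Q) (fromℕ-+ 1 N))) ⟩
  (1ℚ ℚ.+ fromℕ N) ℚ.* fromℕ Q ℚ.* (1/N ℚ.* K/Q)
    ≡⟨ solve 4 (λ n q m k → (con 1ℚ :+ n) :* q :* (m :* k) :=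
         (n :* m) :* (q :* k) :+ m :* (q :* k)) refl (fromℕ N) (fromℕ Q) 1/N K/Q ⟩
  (fromℕ N ℚ.* 1/N) ℚ.* (fromℕ Q ℚ.* K/Q) ℚ.+ 1/N ℚ.* (fromℕ Q ℚ.* K/Q)
    ≡⟨ cong₂ (λ u v → u ℚ.* v ℚ.+ 1/N ℚ.* v) (/-cancel (+ 1) N) (/-cancel (+ K) Q) ⟩
  1ℚ ℚ.* fromℕ K ℚ.+ 1/N ℚ.* fromℕ K
    ≤⟨ ℚ.+-mono-≤ (ℚ.≤-reflexive (ℚ.*-identityˡ (fromℕ K)))
         (ℚ.*-monoˡ-≤-nonNeg 1/N {{ℚ.normalize-nonNeg 1 N}} (fromℕ-mono-≤ K≤N)) ⟩
  fromℕ K ℚ.+ 1/N ℚ.* fromℕ N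
    ≡⟨ cong (fromℕ K ℚ.+_) (trans (ℚ.*-comm 1/N (fromℕ N)) (/-cancel (+ 1) N)) ⟩
  fromℕ K ℚ.+ 1ℚ ∎
  where
  open ℚS.+-*-Solver
  open ℚ.≤-Reasoning
  1/N = (+ 1) ℚ./ N
  K/Q = (+ K) ℚ./ Q

-- Digits

applyUpTo-++ : {A : Set} (f : ℕ → A) → ∀ m n →
               applyUpTo f (m ℕ.+ n) ≡ applyUpTo f m ++ applyUpTo (f ∘ (m ℕ.+_)) n
applyUpTo-++ f zero    n = refl
applyUpTo-++ f (suc m) n = cong (f 0 ∷_) (applyUpTo-++ (f ∘ suc) m n)

factor-occursAt : {A : Set} (f : ℕ → A) → ∀ {i m L} → i ℕ.+ m ℕ.≤ L →
                  OccursAt (applyUpTo (f ∘ (i ℕ.+_)) m) (applyUpTo f L) i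
factor-occursAt f {i} {m} {L} i+m≤L =
  applyUpTo f i , applyUpTo (f ∘ (i ℕ.+_) ∘ (m ℕ.+_)) rest , List.length-applyUpTo f i ,
  trans (cong (applyUpTo f) (trans (sym (ℕ.m+[n∸m]≡n i+m≤L)) (ℕ.+-assoc i m rest)))
    (trans (applyUpTo-++ f i (m ℕ.+ rest))
      (cong (applyUpTo f i ++_) (applyUpTo-++ (f ∘ (i ℕ.+_)) m rest)))
  where rest = L ℕ.∸ (i ℕ.+ m)

module Digits (b : ℕ) .{{_ : NonTrivial b}} where

  private
    instance
      b≢0 : NonZero b
      b≢0 = ℕ.nonTrivial⇒nonZero b

  value : (ℕ → Fin b) → ℕ → ℕ
  value a zero    = 0
  value a (suc n) = value a n ℕ.* b ℕ.+ toℕ (a n)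

  scaled-partialSum : ∀ a n → fromℕ (b ℕ.^ n) ℚ.* partialSum b a n ≡ fromℕ (value a n)
  scaled-partialSum a zero    = refl
  scaled-partialSum a (suc n) = begin
    B ℚ.* (p ℚ.+ d)                      ≡⟨ ℚ.*-distribˡ-+ B p d ⟩
    B ℚ.* p ℚ.+ B ℚ.* d
      ≡⟨ cong₂ (λ u v → u ℚ.* p ℚ.+ v) (fromℕ-* b (b ℕ.^ n))
           (/-cancel (+ toℕ (a n)) (b ℕ.^ suc n) {{b^n≢0 b (suc n)}}) ⟩
    fromℕ b ℚ.* Bₙ ℚ.* p ℚ.+ D
      ≡⟨ cong (ℚ._+ D) (solve 3 (λ x y z → x :* y :* z := y :* z :* x) refl (fromℕ b) Bₙ p) ⟩
    Bₙ ℚ.* p ℚ.* fromℕ b ℚ.+ D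
      ≡⟨ cong (λ u → u ℚ.* fromℕ b ℚ.+ D) (scaled-partialSum a n) ⟩
    fromℕ (value a n) ℚ.* fromℕ b ℚ.+ D  ≡⟨ cong (ℚ._+ D) (fromℕ-* (value a n) b) ⟨
    fromℕ (value a n ℕ.* b) ℚ.+ D        ≡⟨ fromℕ-+ (value a n ℕ.* b) (toℕ (a n)) ⟨
    fromℕ (value a (suc n))              ∎
    where
    open ℚS.+-*-Solver
    open ≡-Reasoning
    B = fromℕ (b ℕ.^ suc n)
    Bₙ = fromℕ (b ℕ.^ n)
    p = partialSum b a n
    D = fromℕ (toℕ (a n))
    d = _/b^_ b (toℕ (a n)) (suc n)

  -- The later partial sums lie between `partialSum b a n` and `upperSum b a n`, since the former
  -- never decreases and the latter never increases; the upper half is `scaled≤value+1`.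
  value≤scaled : ∀ a {n k} → n ℕ.≤ k → fromℕ (value a n) ℚ.≤ fromℕ (b ℕ.^ n) ℚ.* partialSum b a k
  value≤scaled a {n} {k} n≤k = subst (ℚ._≤ fromℕ (b ℕ.^ n) ℚ.* partialSum b a k)
    (scaled-partialSum a n) (fromℕ-*-mono-≤ (b ℕ.^ n) (partialSum-mono b a n≤k))

  scaled≤value+1 : ∀ a {n k} → n ℕ.≤ k →
                   fromℕ (b ℕ.^ n) ℚ.* partialSum b a k ℚ.≤ fromℕ (value a n) ℚ.+ 1ℚ
  scaled≤value+1 a {n} {k} n≤k = subst (fromℕ (b ℕ.^ n) ℚ.* partialSum b a k ℚ.≤_)
    (trans (ℚ.*-distribˡ-+ (fromℕ (b ℕ.^ n)) (partialSum b a n) (_/b^_ b 1 n))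
      (cong₂ ℚ._+_ (scaled-partialSum a n) (/-cancel (+ 1) (b ℕ.^ n) {{b^n≢0 b n}})))
    (fromℕ-*-mono-≤ (b ℕ.^ n)
      (ℚ.≤-trans (p≤p+d/b^n b (partialSum b a k) 1 k) (upperSum-antimono b a n≤k)))

  value<b^n : ∀ f n → value f n ℕ.< b ℕ.^ n
  value<b^n f zero    = s≤s z≤n
  value<b^n f (suc n) = begin-strict
    value f n ℕ.* b ℕ.+ toℕ (f n)   <⟨ ℕ.+-monoʳ-< (value f n ℕ.* b) (Fin.toℕ<n (f n)) ⟩
    value f n ℕ.* b ℕ.+ b           ≡⟨ ℕ.+-comm (value f n ℕ.* b) b ⟩
    suc (value f n) ℕ.* b           ≤⟨ ℕ.*-monoˡ-≤ b (value<b^n f n) ⟩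
    b ℕ.^ n ℕ.* b                   ≡⟨ ℕ.*-comm (b ℕ.^ n) b ⟩
    b ℕ.^ suc n                     ∎
    where open ℕ.≤-Reasoning

  value-+ : ∀ f n r → value f (n ℕ.+ r) ≡ value f n ℕ.* b ℕ.^ r ℕ.+ value (f ∘ (n ℕ.+_)) r
  value-+ f n zero    = trans (cong (value f) (ℕ.+-identityʳ n))
    (sym (trans (ℕ.+-identityʳ _) (ℕ.*-identityʳ (value f n))))
  value-+ f n (suc r) = trans (cong (value f) (ℕ.+-suc n r))
    (trans (cong (λ v → v ℕ.* b ℕ.+ d) (value-+ f n r))
      (solve 5 (λ v p w b d → (v :* p :+ w) :* b :+ d := v :* (b :* p) :+ (w :* b :+ d)) refl
        (value f n) (b ℕ.^ r) (value (f ∘ (n ℕ.+_)) r) b d))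
    where
    open ℕS.+-*-Solver
    d = toℕ (f (n ℕ.+ r))

  value-injective : ∀ f g n → value f n ≡ value g n → applyUpTo f n ≡ applyUpTo g n
  value-injective f g zero    _  = refl
  value-injective f g (suc n) eq = trans (sym (List.applyUpTo-∷ʳ f n)) (trans
    (cong₂ _∷ʳ_ (value-injective f g n quotient) (Fin.toℕ-injective last))
    (List.applyUpTo-∷ʳ g n))
    where
    last-digit : ∀ h → value h (suc n) % b ≡ toℕ (h n)
    last-digit h = trans (cong (_% b) (ℕ.+-comm (value h n ℕ.* b) (toℕ (h n))))
      (trans ([m+kn]%n≡m%n (toℕ (h n)) (value h n) b) (m<n⇒m%n≡m (Fin.toℕ<n (h n))))
    last : toℕ (f n) ≡ toℕ (g n)
    last = trans (sym (last-digit f)) (trans (cong (_% b) eq) (last-digit g))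
    quotient : value f n ≡ value g n
    quotient = ℕ.*-cancelʳ-≡ _ _ b (ℕ.+-cancelʳ-≡ (toℕ (f n)) _ _
      (trans eq (cong (value g n ℕ.* b ℕ.+_) (sym last))))

  -- Modulo `bᵐ` only the last `m` of the `l + m` digits survive, and they spell the factor of
  -- length `m` that starts at `l`. Equal residues thus give equal factors, and a factor occurs only
  -- once in the prefix.
  deBruijn⇒injective : ∀ {a m l l′} →
    IsDeBruijnWord b m (applyUpTo a (b ℕ.^ m ℕ.+ m ℕ.∸ 1)) → l ℕ.< b ℕ.^ m → l′ ℕ.< b ℕ.^ m →
    (value a (l ℕ.+ m) % b ℕ.^ m) {{b^n≢0 b m}} ≡ (value a (l′ ℕ.+ m) % b ℕ.^ m) {{b^n≢0 b m}} →
    l ≡ l′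
  deBruijn⇒injective {a} {m} {l} {l′} (_ , occurs) l<M l′<M eq =
    trans (sym (proj₂ (proj₂ once) (occ l<M)))
      (proj₂ (proj₂ once)
        (subst (λ u → OccursAt u (applyUpTo a (M ℕ.+ m ℕ.∸ 1)) l′) (sym same) (occ l′<M)))
    where
    M = b ℕ.^ m
    instance
      M≢0 : NonZero M
      M≢0 = b^n≢0 b m
    word : ℕ → List (Fin b)
    word n = applyUpTo (a ∘ (n ℕ.+_)) m
    residue : ∀ n → value a (n ℕ.+ m) % M ≡ value (a ∘ (n ℕ.+_)) m
    residue n = trans (cong (_% M) (trans (value-+ a n m) (ℕ.+-comm (value a n ℕ.* M) _)))
      (trans ([m+kn]%n≡m%n _ (value a n) M) (m<n⇒m%n≡m (value<b^n (a ∘ (n ℕ.+_)) m)))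
    same : word l ≡ word l′
    same = value-injective (a ∘ (l ℕ.+_)) (a ∘ (l′ ℕ.+_)) m
      (trans (sym (residue l)) (trans eq (residue l′)))
    once = occurs (word l) (List.length-applyUpTo (a ∘ (l ℕ.+_)) m)
    occ : ∀ {n} → n ℕ.< M → OccursAt (word n) (applyUpTo a (M ℕ.+ m ℕ.∸ 1)) n
    -- The last admissible start `M − 1` gives a factor that ends exactly at the end of the prefix,
    -- of length `M + m − 1`.
    occ n<M = factor-occursAt a (ℕ.≤-pred (ℕ.≤-trans (ℕ.+-monoˡ-≤ m n<M)
      (ℕ.≤-reflexive (sym (ℕ.m+[n∸m]≡n (ℕ.≤-trans (ℕ.m^n>0 b m) (ℕ.m≤m+n M m)))))))

  -- Odd orders are the ones that both clauses of the definition, for `b ≥ 3` and for `b = 2`,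
  -- supply.
  odd-prefix : ∀ {a} → IsInfiniteDeBruijnWord b a → ∀ k → let m = suc (2 ℕ.* k) in
               IsDeBruijnWord b m (applyUpTo a (b ℕ.^ m ℕ.+ m ℕ.∸ 1))
  odd-prefix (large , binary) k with ℕ.m≤n⇒m<n∨m≡n (ℕ.nonTrivial⇒n>1 b)
  ... | inj₁ 3≤b = large 3≤b (suc (2 ℕ.* k)) (s≤s z≤n)
  ... | inj₂ 2≡b = binary (sym 2≡b) (suc (2 ℕ.* k)) λ 2∣ →
    contradiction (∣1⇒≡1 (∣m+n∣m⇒∣n (subst (2 ∣_) (ℕ.+-comm 1 (2 ℕ.* k)) 2∣) (m∣m*n k))) λ ()

  -- Odd powers of `b` exceed any threshold, so the `N` with `N + 1 = bᵐ` may be taken as large as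
  -- the Poissonian limit requires.
  power-large : ∀ k → ∃ λ N → b ℕ.^ suc (2 ℕ.* k) ≡ suc N × k ℕ.≤ N
  power-large k = ℕ.pred M , sym (ℕ.suc-pred M {{b^n≢0 b (suc (2 ℕ.* k))}}) , ℕ.≤-pred (begin
    suc k             ≤⟨ ℕ.+-mono-≤ (ℕ.m^n>0 b (2 ℕ.* k))
                           (ℕ.≤-trans (ℕ.m≤m+n k (k ℕ.+ 0)) (n≤b^n b (2 ℕ.* k))) ⟩
    p ℕ.+ p           ≡⟨ cong (p ℕ.+_) (ℕ.+-identityʳ p) ⟨
    2 ℕ.* p           ≤⟨ ℕ.*-monoˡ-≤ p (ℕ.nonTrivial⇒n>1 b) ⟩
    M                 ≡⟨ ℕ.suc-pred M {{b^n≢0 b (suc (2 ℕ.* k))}} ⟨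
    suc (ℕ.pred M)    ∎)
    where
    open ℕ.≤-Reasoning
    p = b ℕ.^ (2 ℕ.* k)
    M = b ℕ.^ suc (2 ℕ.* k)

  -- Close pairs in terms of digits

  module _ (a : ℕ → Fin b) (x : ℕ → ℝ)
           (frac : ∀ n → IsFractionalPart (fromℕ (b ℕ.^ n) · expansion b a) (x n)) where

    private
      -- The integer part of `bⁿ α`.
      k : ℕ → ℤ
      k n = proj₁ (proj₂ (proj₂ (frac n)))

    -- Half of the nearness required by `int-near⇒follows`, with all reals read off at one index
    -- `j`. The 3 added to `K` is one unit for cutting off the digits after the first `m + t`, one
    -- for the three `ε`, and one for the excess in `scaled-gap`.
    one-sided : ∀ {W t Q K N l m j ε r} .{{_ : NonZero Q}} .{{_ : NonZero N}} →
      W ≡ b ℕ.^ t → W ≡ suc N ℕ.* Q → K ℕ.≤ N → l ℕ.+ t ℕ.≤ j → m ℕ.+ t ℕ.≤ j →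
      fromℕ W ℚ.* (ε ℚ.+ ε ℚ.+ ε) ≡ 1ℚ →
      fromℕ (b ℕ.^ l) ℚ.* partialSum b a j ℚ.- seq (x l) j ℚ.≤ fromℤ (k l) ℚ.+ ε →
      fromℤ (k m) ℚ.≤ fromℕ (b ℕ.^ m) ℚ.* partialSum b a j ℚ.- seq (x m) j ℚ.+ ε →
      seq (x l) j ℚ.- seq (x m) j ℚ.- fromℤ r ℚ.≤ (+ 1) ℚ./ N ℚ.* ((+ K) ℚ./ Q) ℚ.+ ε →
      + value a (l ℕ.+ t) ℤ.≤ + value a (m ℕ.+ t) ℤ.+ (k l ℤ.- k m ℤ.+ r) ℤ.* + W ℤ.+ + (3 ℕ.+ K)
    one-sided {W} {t} {Q} {K} {N} {l} {m} {j} {ε} {r} W≡ W≡′ K≤N l≤j m≤j hε hl hm hx =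
      fromℤ-cancel-≤ (subst (fromℕ (value a (l ℕ.+ t)) ℚ.≤_) (sym eq)
        (compare-words (fromℕ W)
          (fromℕ (b ℕ.^ l) ℚ.* partialSum b a j) (fromℕ (b ℕ.^ m) ℚ.* partialSum b a j)
          (fromℕ (value a (l ℕ.+ t))) (fromℕ (value a (m ℕ.+ t)))
          (seq (x l) j) (seq (x m) j) ε ((+ 1) ℚ./ N ℚ.* ((+ K) ℚ./ Q))
          (fromℤ (k l)) (fromℤ (k m)) (fromℤ r) (fromℕ K)
          (subst (fromℕ (value a (l ℕ.+ t)) ℚ.≤_) (rescale l) (value≤scaled a l≤j))
          (subst (ℚ._≤ fromℕ (value a (m ℕ.+ t)) ℚ.+ 1ℚ) (rescale m) (scaled≤value+1 a m≤j))
          hl hm hx (fromℕ-*-mono-≤ W)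
          (subst (λ w → fromℕ w ℚ.* ((+ 1) ℚ./ N ℚ.* ((+ K) ℚ./ Q)) ℚ.≤ fromℕ K ℚ.+ 1ℚ) (sym W≡′)
            (scaled-gap K≤N))
          hε))
      where
      rescale : ∀ n → fromℕ (b ℕ.^ (n ℕ.+ t)) ℚ.* partialSum b a j ≡
                      fromℕ W ℚ.* (fromℕ (b ℕ.^ n) ℚ.* partialSum b a j)
      rescale n = trans
        (cong (ℚ._* partialSum b a j) (trans
          (cong fromℕ (trans (ℕ.^-distribˡ-+-* b n t)
            (trans (ℕ.*-comm (b ℕ.^ n) (b ℕ.^ t)) (cong (ℕ._* b ℕ.^ n) (sym W≡)))))
          (fromℕ-* W (b ℕ.^ n))))
        (ℚ.*-assoc (fromℕ W) (fromℕ (b ℕ.^ n)) (partialSum b a j))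
      z = k l ℤ.- k m ℤ.+ r
      Y = + value a (m ℕ.+ t)
      eq : fromℤ (Y ℤ.+ z ℤ.* + W ℤ.+ + (3 ℕ.+ K)) ≡
           fromℤ Y ℚ.+ (fromℤ (k l) ℚ.- fromℤ (k m) ℚ.+ fromℤ r) ℚ.* fromℕ W ℚ.+
             (1ℚ ℚ.+ 1ℚ ℚ.+ 1ℚ ℚ.+ fromℕ K)
      eq = trans (fromℤ-+ (Y ℤ.+ z ℤ.* + W) (+ (3 ℕ.+ K))) (cong₂ ℚ._+_
        (trans (fromℤ-+ Y (z ℤ.* + W)) (cong (fromℤ Y ℚ.+_) (trans (fromℤ-* z (+ W))
          (cong (ℚ._* fromℕ W) (trans (fromℤ-+ (k l ℤ.- k m) r) (cong (ℚ._+ fromℤ r)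
            (trans (fromℤ-+ (k l) (ℤ.- k m)) (cong (fromℤ (k l) ℚ.+_) (fromℤ-neg (k m))))))))))
        (fromℕ-+ 3 K))

    -- The integer parts `k l`, `k m` and the rounding `r` of `x l − x m` at index `j` combine to
    -- the number `z` of full turns between the two points on the circle of circumference `W`; every
    -- other discrepancy fits into `3 + K`.
    close⇒follows : ∀ {t Q K N l m} .{{_ : NonZero Q}} .{{_ : NonZero N}} →
      b ℕ.^ t ≡ suc N ℕ.* Q → K ℕ.≤ N → ClosePair x (fromℚ ((+ K) ℚ./ Q)) N (l , m) →
      Follows (suc N ℕ.* Q) (3 ℕ.+ K) (value a (l ℕ.+ t)) (value a (m ℕ.+ t)) ⊎
      Follows (suc N ℕ.* Q) (3 ℕ.+ K) (value a (m ℕ.+ t)) (value a (l ℕ.+ t))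
    close⇒follows {t} {Q} {K} {N} {l} {m} W≡ K≤N (_ , _ , _ , close) =
      int-near⇒follows z
        (one-sided {t = t} (sym W≡) refl K≤N l≤j m≤j hε (l≤ j j₀≤j) (m≥ j j₀≤j)
          (ℚ.≤-trans (p≤∣p∣ (q ℚ.- fromℤ r)) (close′ j j₀≤j)))
        -- The same estimate with `l` and `m` exchanged, hence with `− r` for `r` and `− z` turns;
        -- adding `z W` to both sides moves the turns to the left.
        (subst (+ value a (m ℕ.+ t) ℤ.+ z ℤ.* + W ℤ.≤_)
          (eq (+ value a (l ℕ.+ t)) (k l) (k m) r (+ W) (+ (3 ℕ.+ K)))
          (ℤ.+-monoˡ-≤ (z ℤ.* + W)
            (one-sided {t = t} (sym W≡) refl K≤N m≤j l≤j hε (m≤ j j₀≤j) (l≥ j j₀≤j)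
              (ℚ.≤-trans (ℚ.≤-reflexive flip)
                (ℚ.≤-trans (-p≤∣p∣ (q ℚ.- fromℤ r)) (close′ j j₀≤j))))))
      where
      open ℚS.+-*-Solver
      W = suc N ℕ.* Q
      ε,h = third W {{ℕ.m*n≢0 (suc N) Q}}
      ε = proj₁ ε,h
      ε>0 = proj₁ (proj₂ ε,h)
      hε = proj₂ (proj₂ ε,h)
      integer : ∀ n → fromℕ (b ℕ.^ n) · expansion b a -ᴿ x n ≈ᴿ fromℚ (fromℤ (k n))
      integer n = proj₂ (proj₂ (proj₂ (frac n)))
      eventually =
        (proj₁ (integer l) ε ε>0 ∩ proj₂ (integer l) ε ε>0) ∩
        (proj₁ (integer m) ε ε>0 ∩ proj₂ (integer m) ε ε>0) ∩ close ε ε>0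
      j₀ = proj₁ eventually
      -- Late enough for all five inequalities in `eventually`, and at least both digit lengths
      -- `l + t` and `m + t`.
      j = j₀ ℕ.+ ((l ℕ.+ t) ℕ.+ (m ℕ.+ t))
      j₀≤j : j₀ ℕ.≤ j
      j₀≤j = ℕ.m≤m+n j₀ _
      l≤j : l ℕ.+ t ℕ.≤ j
      l≤j = ℕ.≤-trans (ℕ.m≤m+n (l ℕ.+ t) (m ℕ.+ t)) (ℕ.m≤n+m _ j₀)
      m≤j : m ℕ.+ t ℕ.≤ j
      m≤j = ℕ.≤-trans (ℕ.m≤n+m (m ℕ.+ t) (l ℕ.+ t)) (ℕ.m≤n+m _ j₀)
      l≤ : ∀ n → j₀ ℕ.≤ n → _
      l≤ n j₀≤n = proj₁ (proj₁ (proj₂ eventually n j₀≤n))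
      l≥ : ∀ n → j₀ ℕ.≤ n → _
      l≥ n j₀≤n = proj₂ (proj₁ (proj₂ eventually n j₀≤n))
      m≤ : ∀ n → j₀ ℕ.≤ n → _
      m≤ n j₀≤n = proj₁ (proj₁ (proj₂ (proj₂ eventually n j₀≤n)))
      m≥ : ∀ n → j₀ ℕ.≤ n → _
      m≥ n j₀≤n = proj₂ (proj₁ (proj₂ (proj₂ eventually n j₀≤n)))
      close′ : ∀ n → j₀ ℕ.≤ n → _
      close′ n j₀≤n = proj₂ (proj₂ (proj₂ eventually n j₀≤n))
      q = seq (x l) j ℚ.- seq (x m) j
      r = round q
      z = k l ℤ.- k m ℤ.+ r
      flip : seq (x m) j ℚ.- seq (x l) j ℚ.- fromℤ (ℤ.- r) ≡ ℚ.- (q ℚ.- fromℤ r)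
      flip = trans (cong (λ u → seq (x m) j ℚ.- seq (x l) j ℚ.- u) (fromℤ-neg r))
        (solve 3 (λ x y r → y :- x :- (:- r) := :- (x :- y :- r)) refl
          (seq (x l) j) (seq (x m) j) (fromℤ r))
      eq : ∀ v i j r w h → v ℤ.+ (j ℤ.- i ℤ.+ ℤ.- r) ℤ.* w ℤ.+ h ℤ.+ (i ℤ.- j ℤ.+ r) ℤ.* w ≡ v ℤ.+ h
      eq = S.solve 6 (λ v i j r w h →
        v S.:+ (j S.:- i S.:+ (S.:- r)) S.:* w S.:+ h S.:+ (i S.:- j S.:+ r) S.:* w S.:=
        v S.:+ h) refl
        where module S = ℤS.+-*-Solver

-- Counting close pairs

-- `P` is undecidable in the intended use, but under a double negation it may be decided for each of
-- the finitely many entries in turn.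
¬¬-filter : {A : Set} (P : Pred A 0ℓ) → ∀ {xs} → Unique xs →
            ¬ ¬ ∃ λ ps → Unique ps × (∀ p → p ∈ ps ⇔ (p ∈ xs × P p))
¬¬-filter P [] found = found ([] , [] , λ _ → mk⇔ (λ ()) (λ ()))
¬¬-filter P {x ∷ xs} (x∉xs ∷ u) found = ¬¬-filter P u λ (ps , ups , eqv) →
  let to = λ {p} → Equivalence.to (eqv p); from = λ {p} → Equivalence.from (eqv p) in
  ¬¬-excluded-middle λ where
    (yes Px) → found (x ∷ ps ,
      All.tabulate (λ y∈ps → All.lookup x∉xs (proj₁ (to y∈ps))) ∷ ups ,
      λ p → mk⇔
        (λ { (here refl) → here refl , Px ; (there p∈) → there (proj₁ (to p∈)) , proj₂ (to p∈) })
        (λ { (here refl , _) → here refl ; (there p∈ , Pp) → there (from (p∈ , Pp)) }))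
    (no ¬Px) → found (ps , ups , λ p → mk⇔
      (λ p∈ → there (proj₁ (to p∈)) , proj₂ (to p∈))
      (λ { (here refl , Px) → contradiction Px ¬Px ; (there p∈ , Pp) → from (p∈ , Pp) }))

-- The Poissonian condition speaks of a given count `c`, so one has to be produced. Filtering the
-- square of `0, …, N` does so under a double negation, which is enough to refute something.
¬¬-cardinality : ∀ x s N .{{_ : NonZero N}} → ¬ ¬ ∃ (HasCardinality (ClosePair x s N))
¬¬-cardinality x s N found =
  ¬¬-filter (ClosePair x s N)
    (Unique.cartesianProduct⁺ (Unique.upTo⁺ (suc N)) (Unique.upTo⁺ (suc N)))
    λ (ps , ups , eqv) → found (length ps , ps , ups , refl , λ p → mk⇔
      (λ p∈ → proj₂ (Equivalence.to (eqv p) p∈))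
      (λ close@((_ , l≤N) , (_ , m≤N) , _) → Equivalence.from (eqv p)
        (List.∈-cartesianProduct⁺ (List.∈-upTo⁺ (s≤s l≤N)) (List.∈-upTo⁺ (s≤s m≤N)) , close)))

-- With `s = K/Q`, the ratio `c / N` is at least `2 s − 1/Q` for large `N`; multiplication by `Q N`
-- clears the denominators.
poissonian⇒many-close-pairs : ∀ x → HasPoissonianPairCorrelations x →
  ∀ Q K .{{_ : NonZero Q}} → ∃ λ N₀ → ∀ N .{{_ : NonZero N}} → N₀ ℕ.≤ N →
  ∀ c → HasCardinality (ClosePair x (fromℚ ((+ K) ℚ./ Q)) N) c →
  2 ℕ.* K ℕ.* N ℕ.≤ Q ℕ.* c ℕ.+ N
poissonian⇒many-close-pairs x poisson Q K = proj₁ h , bound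
  where
  instance
    2Q≢0 : NonZero (2 ℕ.* Q)
    2Q≢0 = ℕ.m*n≢0 2 Q
  s = (+ K) ℚ./ Q
  0≤s : fromℚ 0ℚ ≤ᴿ fromℚ s
  0≤s ε 0<ε = 0 , λ _ _ → ℚ.+-mono-≤ (ℚ.nonNegative⁻¹ s {{ℚ.normalize-nonNeg K Q}}) (ℚ.<⇒≤ 0<ε)
  -- Half of `1/Q`: one `ε` is the accuracy of the limit, the other the tolerance in `_≤ᴿ_`.
  ε = (+ 1) ℚ./ (2 ℕ.* Q)
  h = poisson (fromℚ s) 0≤s ε (1/n-pos (2 ℕ.* Q))
  bound : ∀ N .{{_ : NonZero N}} → proj₁ h ℕ.≤ N →
          ∀ c → HasCardinality (ClosePair x (fromℚ s) N) c →
          2 ℕ.* K ℕ.* N ℕ.≤ Q ℕ.* c ℕ.+ N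
  bound N N₀≤N c card = fromℕ-cancel-≤ (begin
    fromℕ (2 ℕ.* K ℕ.* N)
      ≡⟨ trans (fromℕ-* (2 ℕ.* K) N) (cong (ℚ._* n)
           (trans (fromℕ-* 2 K) (cong (fromℕ 2 ℚ.*_) (sym (/-cancel (+ K) Q))))) ⟩
    fromℕ 2 ℚ.* (q ℚ.* s) ℚ.* n
      ≡⟨ solve 5 (λ t q s n d → t :* (q :* s) :* n :=
           q :* (n :* (:- (d :- t :* s))) :+ q :* (n :* d)) refl (fromℕ 2) q s n d ⟩
    q ℚ.* (n ℚ.* (ℚ.- (d ℚ.- fromℕ 2 ℚ.* s))) ℚ.+ q ℚ.* (n ℚ.* d)
      ≤⟨ ℚ.+-monoˡ-≤ (q ℚ.* (n ℚ.* d)) (fromℕ-*-mono-≤ Q (fromℕ-*-mono-≤ N near)) ⟩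
    q ℚ.* (n ℚ.* (ε ℚ.+ ε)) ℚ.+ q ℚ.* (n ℚ.* d)
      ≡⟨ solve 4 (λ q n e u → q :* (n :* (e :+ e)) :+ q :* u :=
           q :* u :+ (con (fromℕ 2) :* q :* e) :* n) refl q n ε (n ℚ.* d) ⟩
    q ℚ.* (n ℚ.* d) ℚ.+ fromℕ 2 ℚ.* q ℚ.* ε ℚ.* n
      ≡⟨ cong₂ (λ u v → q ℚ.* u ℚ.+ v ℚ.* n) (/-cancel (+ c) N)
           (trans (cong (ℚ._* ε) (sym (fromℕ-* 2 Q))) (/-cancel (+ 1) (2 ℕ.* Q))) ⟩
    q ℚ.* fromℕ c ℚ.+ 1ℚ ℚ.* n
      ≡⟨ cong₂ ℚ._+_ (sym (fromℕ-* Q c)) (ℚ.*-identityˡ n) ⟩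
    fromℕ (Q ℕ.* c) ℚ.+ n      ≡⟨ fromℕ-+ (Q ℕ.* c) N ⟨
    fromℕ (Q ℕ.* c ℕ.+ N)      ∎)
    where
    open ℚ.≤-Reasoning
    open ℚS.+-*-Solver
    q = fromℕ Q
    n = fromℕ N
    d = (+ c) ℚ./ N
    close = proj₂ h N N₀≤N c card ε (1/n-pos (2 ℕ.* Q))
    near : ℚ.- (d ℚ.- fromℕ 2 ℚ.* s) ℚ.≤ ε ℚ.+ ε
    near = ℚ.≤-trans (-p≤∣p∣ (d ℚ.- fromℕ 2 ℚ.* s)) (proj₂ close (proj₁ close) ℕ.≤-refl)

-- Used with b = 2 + β, H = b⁴ = 16 + h, Q = b⁵ and D = Q − H.
links-contradiction : ∀ β h {Q D K₁ e₁ e₂ c₁ c₂ N} →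
  let H = 16 ℕ.+ h; K₂ = 13 ℕ.+ h in
  Q ≡ (2 ℕ.+ β) ℕ.* H → D ≡ (1 ℕ.+ β) ℕ.* H → 3 ℕ.+ K₁ ≡ Q →
  c₁ ℕ.≤ e₁ → c₂ ℕ.≤ e₂ → Q ℕ.* e₁ ℕ.+ D ℕ.* e₂ ℕ.≤ suc N ℕ.* (2 ℕ.* Q) →
  2 ℕ.* K₁ ℕ.* N ℕ.≤ Q ℕ.* c₁ ℕ.+ N → 2 ℕ.* K₂ ℕ.* N ℕ.≤ Q ℕ.* c₂ ℕ.+ N →
  2 ℕ.* Q ℕ.* Q ℕ.< N → ⊥
links-contradiction β h {Q} {D} {K₁} {e₁} {e₂} {c₁} {c₂} {N} Q≡ D≡ K₁≡ c₁≤ c₂≤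
  total many₁ many₂ N-large =
  ℕ.<⇒≱ small large
  where
  open ℕ.≤-Reasoning
  open ℕS.+-*-Solver
  K₂ = 13 ℕ.+ h
  -- The weights `Q` and `D` are those of the link counts in `total`, so the Poissonian lower bounds
  -- meet its upper bound.
  weighted : (2 ℕ.* Q ℕ.* K₁ ℕ.+ 2 ℕ.* D ℕ.* K₂) ℕ.* N ℕ.< (2 ℕ.* Q ℕ.* Q ℕ.+ Q ℕ.+ D ℕ.+ 1) ℕ.* N
  weighted = begin-strict
    (2 ℕ.* Q ℕ.* K₁ ℕ.+ 2 ℕ.* D ℕ.* K₂) ℕ.* N
      ≡⟨ solve 5 (λ q k d l n → (con 2 :* q :* k :+ con 2 :* d :* l) :* n :=
            q :* (con 2 :* k :* n) :+ d :* (con 2 :* l :* n)) refl Q K₁ D K₂ N ⟩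
    Q ℕ.* (2 ℕ.* K₁ ℕ.* N) ℕ.+ D ℕ.* (2 ℕ.* K₂ ℕ.* N)
      ≤⟨ ℕ.+-mono-≤
           (ℕ.*-monoʳ-≤ Q (ℕ.≤-trans many₁ (ℕ.+-monoˡ-≤ N (ℕ.*-monoʳ-≤ Q c₁≤))))
           (ℕ.*-monoʳ-≤ D (ℕ.≤-trans many₂ (ℕ.+-monoˡ-≤ N (ℕ.*-monoʳ-≤ Q c₂≤)))) ⟩
    Q ℕ.* (Q ℕ.* e₁ ℕ.+ N) ℕ.+ D ℕ.* (Q ℕ.* e₂ ℕ.+ N)
      ≡⟨ solve 5 (λ q e d f n → q :* (q :* e :+ n) :+ d :* (q :* f :+ n) :=
            q :* (q :* e :+ d :* f) :+ (q :+ d) :* n) refl Q e₁ D e₂ N ⟩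
    Q ℕ.* (Q ℕ.* e₁ ℕ.+ D ℕ.* e₂) ℕ.+ (Q ℕ.+ D) ℕ.* N
      ≤⟨ ℕ.+-monoˡ-≤ _ (ℕ.*-monoʳ-≤ Q total) ⟩
    Q ℕ.* (suc N ℕ.* (2 ℕ.* Q)) ℕ.+ (Q ℕ.+ D) ℕ.* N
      ≡⟨ solve 3 (λ q d n → q :* ((con 1 :+ n) :* (con 2 :* q)) :+ (q :+ d) :* n :=
            (con 2 :* q :* q :+ q :+ d) :* n :+ con 2 :* q :* q) refl Q D N ⟩
    (2 ℕ.* Q ℕ.* Q ℕ.+ Q ℕ.+ D) ℕ.* N ℕ.+ 2 ℕ.* Q ℕ.* Q
      -- The size of `N` absorbs the term `2 Q²` that comes from `suc N` in place of `N`.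
      <⟨ ℕ.+-monoʳ-< _ N-large ⟩
    (2 ℕ.* Q ℕ.* Q ℕ.+ Q ℕ.+ D) ℕ.* N ℕ.+ N
      ≡⟨ solve 2 (λ x n → x :* n :+ n := (x :+ con 1) :* n) refl (2 ℕ.* Q ℕ.* Q ℕ.+ Q ℕ.+ D) N ⟩
    (2 ℕ.* Q ℕ.* Q ℕ.+ Q ℕ.+ D ℕ.+ 1) ℕ.* N ∎
  -- Since `K₁ = Q − 3`, the main terms `2 Q²` cancel and leave `6 Q`.
  small : 2 ℕ.* D ℕ.* K₂ ℕ.< 7 ℕ.* Q ℕ.+ D ℕ.+ 1
  small = ℕ.+-cancelˡ-< (2 ℕ.* Q ℕ.* Q) _ _ (begin-strict
    2 ℕ.* Q ℕ.* Q ℕ.+ 2 ℕ.* D ℕ.* K₂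
      ≡⟨ cong (λ u → 2 ℕ.* Q ℕ.* u ℕ.+ 2 ℕ.* D ℕ.* K₂) K₁≡ ⟨
    2 ℕ.* Q ℕ.* (3 ℕ.+ K₁) ℕ.+ 2 ℕ.* D ℕ.* K₂
      ≡⟨ solve 3 (λ q k s → con 2 :* q :* (con 3 :+ k) :+ s := (con 2 :* q :* k :+ s) :+ con 6 :* q)
           refl Q K₁ (2 ℕ.* D ℕ.* K₂) ⟩
    2 ℕ.* Q ℕ.* K₁ ℕ.+ 2 ℕ.* D ℕ.* K₂ ℕ.+ 6 ℕ.* Q
      <⟨ ℕ.+-monoˡ-< (6 ℕ.* Q) (ℕ.*-cancelʳ-< N
           (2 ℕ.* Q ℕ.* K₁ ℕ.+ 2 ℕ.* D ℕ.* K₂) (2 ℕ.* Q ℕ.* Q ℕ.+ Q ℕ.+ D ℕ.+ 1) weighted) ⟩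
    2 ℕ.* Q ℕ.* Q ℕ.+ Q ℕ.+ D ℕ.+ 1 ℕ.+ 6 ℕ.* Q
      ≡⟨ solve 2 (λ q d → con 2 :* q :* q :+ q :+ d :+ con 1 :+ con 6 :* q :=
            con 2 :* q :* q :+ (con 7 :* q :+ d :+ con 1)) refl Q D ⟩
    2 ℕ.* Q ℕ.* Q ℕ.+ (7 ℕ.* Q ℕ.+ D ℕ.+ 1) ∎)
  -- The difference of the two sides is the polynomial with nonnegative coefficients written out
  -- below. For `b = 2` the inequality is `15 H + 1 ≤ 2 H (H − 3)`, false for `H = 8` and true for
  -- `H = 16`, which explains the power `b⁴`.
  large : 7 ℕ.* Q ℕ.+ D ℕ.+ 1 ℕ.≤ 2 ℕ.* D ℕ.* K₂
  large = subst₂ (λ Q D → 7 ℕ.* Q ℕ.+ D ℕ.+ 1 ℕ.≤ 2 ℕ.* D ℕ.* K₂) (sym Q≡) (sym D≡)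
    (ℕ.≤-trans (ℕ.m≤m+n _ _) (ℕ.≤-reflexive
      (solve 2 (λ β h → let H = con 16 :+ h; D = (con 1 :+ β) :* H in
        con 7 :* ((con 2 :+ β) :* H) :+ D :+ con 1 :+
          (con 175 :+ con 11 :* h :+ con 288 :* β :+ con 18 :* β :* h :+ con 2 :* D :* h) :=
        con 2 :* D :* (con 13 :+ h)) refl β h)))

-- The de Bruijn prefix as an arrangement of points in cells

module CloseCells (b : ℕ) .{{_ : NonTrivial b}} (a : ℕ → Fin b) (x : ℕ → ℝ)
                  (frac : ∀ n → IsFractionalPart (fromℕ (b ℕ.^ n) · expansion b a) (x n))
                  {m N : ℕ} .{{_ : NonZero N}} (M≡ : b ℕ.^ m ≡ suc N)
                  (prefix : IsDeBruijnWord b m (applyUpTo a (b ℕ.^ m ℕ.+ m ℕ.∸ 1))) (r : ℕ) where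
  open Digits b

  private
    Q = b ℕ.^ r

    instance
      Q≢0 : NonZero Q
      Q≢0 = b^n≢0 b r

    residue-injective : ∀ {l l′} → l ℕ.< suc N → l′ ℕ.< suc N →
      value a (l ℕ.+ m) % suc N ≡ value a (l′ ℕ.+ m) % suc N → l ≡ l′
    residue-injective = subst
      (λ M → .{{_ : NonZero M}} → ∀ {l l′} → l ℕ.< M → l′ ℕ.< M →
             value a (l ℕ.+ m) % M ≡ value a (l′ ℕ.+ m) % M → l ≡ l′)
      M≡ (deBruijn⇒injective prefix)

  -- Of `n + m + r` digits, the first `n + m` give the cell, of which only the last `m` matter
  -- modulo `suc N`, and the final `r` give the offset inside it.
  open Cells (suc N) Q (λ n → value a (n ℕ.+ m)) (λ n → value (a ∘ (n ℕ.+ m ℕ.+_)) r)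
    (λ n → value<b^n _ r) residue-injective public

  private
    value-split : ∀ n → value a (n ℕ.+ (m ℕ.+ r)) ≡
                        value a (n ℕ.+ m) ℕ.* Q ℕ.+ value (a ∘ (n ℕ.+ m ℕ.+_)) r
    value-split n = trans (cong (value a) (sym (ℕ.+-assoc n m r))) (value-+ a (n ℕ.+ m) r)

  closePairs≤links : ∀ {K c} → 3 ℕ.+ K ℕ.≤ Q → K ℕ.≤ N →
    HasCardinality (ClosePair x (fromℚ ((+ K) ℚ./ Q)) N) c → c ℕ.≤ length (links (3 ℕ.+ K) (suc N))
  closePairs≤links {K} 3+K≤Q K≤N (ps , unique , refl , eqv) = Unique-⊆⇒length≤ unique λ {p} p∈ →
    let close@((_ , l≤N) , (_ , m≤N) , l≢m , _) = Equivalence.to (eqv p) p∈ in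
    -- The indices `1, …, N` of a close pair are among the `N + 1` starts `0, …, N` that fill the
    -- cells; the point with index 0 occupies a cell without being counted.
    follows⇒∈-links 3+K≤Q (s≤s l≤N) (s≤s m≤N) l≢m
      (subst₂ (λ u v → Follows (suc N ℕ.* Q) (3 ℕ.+ K) u v ⊎ Follows (suc N ℕ.* Q) (3 ℕ.+ K) v u)
        (value-split (proj₁ p)) (value-split (proj₂ p))
        (close⇒follows a x frac {t = m ℕ.+ r} {Q = Q}
          (trans (ℕ.^-distribˡ-+-* b m r) (cong (ℕ._* Q) M≡)) K≤N close))

theorem2 : (b : ℕ) .{{_ : NonTrivial b}} (a : ℕ → Fin b) →
    IsInfiniteDeBruijnWord b a →
    (x : ℕ → ℝ) →
    (∀ n → IsFractionalPart (fromℤ (+ (b ^ n)) · expansion b a) (x n)) →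
    ¬ HasPoissonianPairCorrelations x
theorem2 b a deBruijn x frac poisson =
  ¬¬-cardinality x s₁ N λ (c₁ , card₁) → ¬¬-cardinality x s₂ N λ (c₂ , card₂) →
    links-contradiction β h Q≡ refl K₁≡
      (subst (λ H → c₁ ℕ.≤ length (L.links H (suc N))) K₁≡
        (L.closePairs≤links (ℕ.≤-reflexive K₁≡) (ℕ.≤-trans (ℕ.m∸n≤m Q 3) Q≤N) card₁))
      (L.closePairs≤links H≤Q (ℕ.≤-trans (ℕ.≤-trans (ℕ.m≤n+m K₂ 3) H≤Q) Q≤N) card₂)
      (L.links-bound H+D≡Q)
      (proj₂ many₁ N (ℕ.≤-trans (ℕ.m≤m+n N₁ N₂) (ℕ.≤-trans (ℕ.m≤m+n (N₁ ℕ.+ N₂) _) k≤N)) c₁ card₁)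
      (proj₂ many₂ N (ℕ.≤-trans (ℕ.m≤n+m N₂ N₁) (ℕ.≤-trans (ℕ.m≤m+n (N₁ ℕ.+ N₂) _) k≤N)) c₂ card₂)
      2QQ<N
  where
  2≤b : 2 ℕ.≤ b
  2≤b = ℕ.nonTrivial⇒n>1 b
  -- As `b ≥ 2`, neither subtraction is truncated: `2 + β` is `b` and `16 + h` is `b⁴`.
  β = b ℕ.∸ 2
  h = b ^ 4 ℕ.∸ 16
  H = 16 ℕ.+ h
  D = (1 ℕ.+ β) ℕ.* H
  Q = b ^ 5
  K₁ = Q ℕ.∸ 3
  -- This is `b⁴ − 3`, written so that `3 + K₂` reduces to `H`.
  K₂ = 13 ℕ.+ h
  Q≡ : Q ≡ (2 ℕ.+ β) ℕ.* H
  Q≡ = sym (cong₂ ℕ._*_ (ℕ.m+[n∸m]≡n 2≤b) (ℕ.m+[n∸m]≡n (ℕ.^-monoˡ-≤ 4 2≤b)))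
  H+D≡Q : H ℕ.+ D ≡ Q
  H+D≡Q = sym Q≡
  H≤Q : H ℕ.≤ Q
  H≤Q = ℕ.≤-trans (ℕ.m≤m+n H D) (ℕ.≤-reflexive H+D≡Q)
  K₁≡ : 3 ℕ.+ K₁ ≡ Q
  K₁≡ = ℕ.m+[n∸m]≡n (ℕ.≤-trans (ℕ.m≤m+n 3 (13 ℕ.+ h)) H≤Q)
  instance
    Q≢0 : NonZero Q
    Q≢0 = b^n≢0 b 5
  s₁ = fromℚ ((+ K₁) ℚ./ Q)
  s₂ = fromℚ ((+ K₂) ℚ./ Q)
  many₁ = poissonian⇒many-close-pairs x poisson Q K₁
  many₂ = poissonian⇒many-close-pairs x poisson Q K₂
  N₁ = proj₁ many₁
  N₂ = proj₁ many₂
  -- Large enough for both Poissonian thresholds and for the bound `2 Q²` of `links-contradiction`;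
  -- the order used is `m = 2 k + 1`.
  k = N₁ ℕ.+ N₂ ℕ.+ suc (2 ℕ.* Q ℕ.* Q)
  large = Digits.power-large b k
  N = proj₁ large
  k≤N : k ℕ.≤ N
  k≤N = proj₂ (proj₂ large)
  2QQ<N : 2 ℕ.* Q ℕ.* Q ℕ.< N
  2QQ<N = ℕ.≤-trans (ℕ.m≤n+m _ (N₁ ℕ.+ N₂)) k≤N
  instance
    N≢0 : NonZero N
    N≢0 = ℕ.>-nonZero (ℕ.≤-<-trans z≤n 2QQ<N)
  Q≤N : Q ℕ.≤ N
  Q≤N = ℕ.≤-trans (ℕ.m≤n*m Q (2 ℕ.* Q) {{ℕ.m*n≢0 2 Q}}) (ℕ.<⇒≤ 2QQ<N)
  module L = CloseCells b a x frac (proj₁ (proj₂ large)) (Digits.odd-prefix b deBruijn k) 5
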